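{- As formal power series in $q$, $$\sum_{\pi\in\mathcal{P}_{dom}} 2^{\tau(\pi)}\, q^{|\pi|} = \sum_{\pi\in\mathcal{U}_{ic}} q^{|\pi|},$$ where, for a partition $\pi$, $\tau(\pi)$ is the number of different even parts of $\pi$ larger than the smallest positive odd integer that is not a part of $\pi$, and the sets of partitions $\mathcal{P}_{dom}$ and $\mathcal{U}_{ic}$ are as defined in the context.
   Context: A partition $\pi$ is a finite non-increasing sequence of positive integers (its parts), and $|\pi|$ is the sum of the parts. The empty sequence is the unique partition of $0$. $\mathcal{P}_{dom}$ is the set of partitions with distinct odd parts (no odd part is repeated; even parts may repeat) such that the smallest positive integer that is not a part of the partition is odd. $\mathcal{U}_{ic}$ is the set of partitions $\pi$ satisfying the following initial condition: if $2j+1$ is the smallest positive odd number that is not a part of $\pi$, then every even positive integer $\leq j$ appears as a part of $\pi$, and every odd positive integer $\leq j$ appears at least twice as a part of $\pi$. "Number of different even parts" means the parts are counted without multiplicity. -}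

module Defs where

open import Data.List.Base using (List; []; _∷_; map; filter; concatMap; length; deduplicate)
open import Data.List.Membership.DecPropositional using () renaming (_∈?_ to mem?)
open import Data.List.Membership.Propositional using (_∈_; _∉_)
open import Data.List.Membership.Propositional.Properties
  using (∈-concatMap⁺; ∈-concatMap⁻; ∈-filter⁺; ∈-filter⁻)
open import Data.List.Relation.Unary.All using (All; []; _∷_; all?)
import Data.List.Relation.Unary.All as All
import Data.List.Relation.Unary.All.Properties as All
open import Data.List.Relation.Unary.AllPairs using (AllPairs; []; _∷_)
import Data.List.Relation.Unary.AllPairs as AllPairs
import Data.List.Relation.Unary.AllPairs.Properties as AllPairs
open import Data.List.Relation.Unary.Any using (Any; here; there)
import Data.List.Relation.Unary.Any as Any
open import Data.List.Relation.Unary.Linked using (Linked; linked?)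
open import Data.List.Relation.Unary.Unique.Propositional using (Unique)
import Data.List.Relation.Unary.Unique.Propositional.Properties as Unique
import Data.List.Relation.Unary.Unique.DecPropositional as DecUnique
open import Data.Nat.Base using (ℕ; zero; suc; _+_; _*_; _≤_; _<_; _≥_; z≤n; s≤s; z<s)
open import Data.Nat.Divisibility using (_∣_; _∤_; _∣?_)
open import Data.Nat.ListAction using (sum)
open import Data.Nat.Properties
  using (_≟_; _<?_; _≤?_; _≥?_; allUpTo?; ≤-trans; m≤m+n; m≤n+m;
         <⇒≱; n<1+n; suc-injective)
open import Data.Product.Base using (_×_; _,_; proj₁; proj₂)
open import Function.Base using (_∘_)
open import Level using (0ℓ)
open import Relation.Binary.PropositionalEquality
  using (_≡_; refl; sym; trans)
open import Relation.Nullary using (¬_; Dec; yes; no; ¬?; _×-dec_; _→-dec_)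
open import Relation.Nullary.Decidable using (map′; decidable-stable)
open import Relation.Unary using (Pred; Decidable)

Even Odd : ℕ → Set
Even n = 2 ∣ n
Odd  n = 2 ∤ n

even? : Decidable Even
even? n = 2 ∣? n

odd? : Decidable Odd
odd? n = ¬? (even? n)

_∈?_ : (k : ℕ) (π : List ℕ) → Dec (k ∈ π)
_∈?_ = mem? _≟_

multiplicity : ℕ → List ℕ → ℕ
multiplicity k π = length (filter (k ≟_) π)

record IsPartition (π : List ℕ) : Set where
  constructor mkIsPartition
  field
    nonIncreasing : Linked _≥_ π
    positive      : All (0 <_) π

isPartition? : Decidable IsPartition
isPartition? π =
  map′ (λ (d , p) → mkIsPartition d p)
       (λ (mkIsPartition d p) → d , p)
       (linked? _≥?_ π ×-dec all? (0 <?_) π)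

-- Compositions of n (lists of positive integers with sum n): a composition
-- of 1 + n arises from a unique composition of n, either by adjoining a
-- leading 1 or by incrementing the head.
grow : List ℕ → List (List ℕ)
grow []      = (1 ∷ []) ∷ []
grow (x ∷ c) = (1 ∷ x ∷ c) ∷ (suc x ∷ c) ∷ []

compositions : ℕ → List (List ℕ)
compositions zero    = [] ∷ []
compositions (suc n) = concatMap grow (compositions n)

partitions : ℕ → List (List ℕ)
partitions n = filter isPartition? (compositions n)

-- The least k ≤ n with P k, or n if there is none.
least : ∀ {P : Pred ℕ 0ℓ} → Decidable P → ℕ → ℕ
least P? zero    = zero
least P? (suc n) with P? 0
... | yes _ = zero
... | no  _ = suc (least (P? ∘ suc) n)

-- The bound sum π suffices in both searches, as no part exceeds sum π;
-- see mex-spec and oddMex-spec.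

-- The smallest positive integer that is not a part.
mex : List ℕ → ℕ
mex π = suc (least (λ k → ¬? (suc k ∈? π)) (sum π))

-- The j for which 2j+1 is the smallest positive odd integer that is not a part.
oddMexIndex : List ℕ → ℕ
oddMexIndex π = least (λ j → ¬? (suc (2 * j) ∈? π)) (sum π)

oddMex : List ℕ → ℕ
oddMex π = suc (2 * oddMexIndex π)

record P-dom (π : List ℕ) : Set where
  constructor mkP-dom
  field
    isPartition      : IsPartition π
    distinctOddParts : Unique (filter odd? π)
    mexIsOdd         : Odd (mex π)

record U-ic (π : List ℕ) : Set where
  constructor mkU-ic
  field
    isPartition : IsPartition π
    initial     : ∀ {i} → i ≤ oddMexIndex π → 0 < i →
                  (Even i → i ∈ π) × (Odd i → 2 ≤ multiplicity i π)

P-dom? : Decidable P-dom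
P-dom? π =
  map′ (λ (p , d , m) → mkP-dom p d m)
       (λ (mkP-dom p d m) → p , d , m)
       (isPartition? π ×-dec DecUnique.unique? _≟_ (filter odd? π) ×-dec odd? (mex π))

U-ic? : Decidable U-ic
U-ic? π =
  map′ (λ (p , c) → mkU-ic p λ i≤j → c (s≤s i≤j))
       (λ (mkU-ic p c) → p , λ { (s≤s i≤j) → c i≤j })
       (isPartition? π ×-dec allUpTo? cond? (suc (oddMexIndex π)))
  where
  cond? : Decidable λ i → 0 < i → (Even i → i ∈ π) × (Odd i → 2 ≤ multiplicity i π)
  cond? i = (0 <? i) →-dec
    ((even? i →-dec (i ∈? π)) ×-dec (odd? i →-dec (2 ≤? multiplicity i π)))

τ : List ℕ → ℕ
τ π = length (deduplicate _≟_ (filter (λ k → even? k ×-dec (oddMex π <? k)) π))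

-- Formal power series, given by their coefficients and compared by _≗_

PowerSeries : Set
PowerSeries = ℕ → ℕ

-- The series Σ_{π ∈ S} w(π) q^{|π|}, for a set S of partitions: its
-- coefficient of qⁿ is the sum of w(π) over the π ∈ S with |π| = n.
generatingSeries : {S : Pred (List ℕ) 0ℓ} → Decidable S → (List ℕ → ℕ) → PowerSeries
generatingSeries S? w n = sum (map w (filter S? (partitions n)))

least-spec : ∀ {P : Pred ℕ 0ℓ} (P? : Decidable P) {n} → P n →
             P (least P? n) × (∀ {k} → k < least P? n → ¬ P k)
least-spec P? {zero}  p = p , λ ()
least-spec P? {suc n} p with P? 0
... | yes p₀ = p₀ , λ ()
... | no ¬p₀ with least-spec (P? ∘ suc) {n} p
...   | q , min = q , λ { {zero} _ → ¬p₀ ; {suc k} (s≤s k<) → min k< }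

∈⇒≤sum : ∀ {k π} → k ∈ π → k ≤ sum π
∈⇒≤sum {π = x ∷ π} (here refl) = m≤m+n x (sum π)
∈⇒≤sum {π = x ∷ π} (there k∈)  = ≤-trans (∈⇒≤sum k∈) (m≤n+m (sum π) x)

>sum⇒∉ : ∀ {k π} → sum π < k → k ∉ π
>sum⇒∉ s<k k∈ = <⇒≱ s<k (∈⇒≤sum k∈)

mex-spec : ∀ π → mex π ∉ π × (∀ {k} → 0 < k → k < mex π → k ∈ π)
mex-spec π with least-spec (λ k → ¬? (suc k ∈? π)) {sum π} (>sum⇒∉ {π = π} (n<1+n _))
... | ∉π , min = ∉π , λ { {suc k} _ (s≤s k<) → decidable-stable (_ ∈? π) (min k<) }

oddMex-spec : ∀ π → oddMex π ∉ π × (∀ {j} → j < oddMexIndex π → suc (2 * j) ∈ π)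
oddMex-spec π with
  least-spec (λ j → ¬? (suc (2 * j) ∈? π)) {sum π} (>sum⇒∉ {π = π} (s≤s (m≤m+n (sum π) _)))
... | ∉π , min = ∉π , λ j< → decidable-stable (_ ∈? π) (min j<)

-- Correctness of the enumeration: partitions n lists every partition of n
-- exactly once.

private
  -- Left inverse of grow.
  shrink : List ℕ → List ℕ
  shrink []              = []
  shrink (zero ∷ c)      = c
  shrink (suc zero ∷ c)  = c
  shrink (2+x@(suc (suc x)) ∷ c) = suc x ∷ c

  Positive : List ℕ → Set
  Positive = All (0 <_)

  grow-sound : ∀ c {d} → d ∈ grow c → Positive c → Positive d × sum d ≡ suc (sum c)
  grow-sound []      (here refl)         _        = z<s ∷ [] , refl
  grow-sound (x ∷ c) (here refl)         ps       = z<s ∷ ps , refl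
  grow-sound (x ∷ c) (there (here refl)) (_ ∷ ps) = z<s ∷ ps , refl

  grow-shrink : ∀ c {d} → d ∈ grow c → Positive c → shrink d ≡ c
  grow-shrink []          (here refl)         _ = refl
  grow-shrink (x ∷ c)     (here refl)         _ = refl
  grow-shrink (suc x ∷ c) (there (here refl)) _ = refl
  grow-shrink (zero ∷ c)  (there (here refl)) (() ∷ _)

  grow-unique : ∀ c → Positive c → Unique (grow c)
  grow-unique []          _ = [] ∷ []
  grow-unique (zero ∷ c)  (() ∷ _)
  grow-unique (suc x ∷ c) _ = ((λ ()) ∷ []) ∷ [] ∷ []

  compositions-sound : ∀ n {c} → c ∈ compositions n → Positive c × sum c ≡ n
  compositions-sound zero    (here refl) = [] , refl
  compositions-sound (suc n) c∈ = go (compositions-sound n) (∈-concatMap⁻ grow c∈)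
    where
    go : ∀ {d cs} → (∀ {c} → c ∈ cs → Positive c × sum c ≡ n) →
         Any (λ c → d ∈ grow c) cs → Positive d × sum d ≡ suc n
    go ih (here {x = c} d∈) with ih (here refl)
    ... | ps , refl = grow-sound c d∈ ps
    go ih (there any) = go (ih ∘ there) any

  compositions-complete : ∀ n {c} → Positive c → sum c ≡ n → c ∈ compositions n
  compositions-complete zero    {[]}        _        _  = here refl
  compositions-complete zero    {suc x ∷ c} _        ()
  compositions-complete zero    {zero ∷ c}  (() ∷ _) _
  compositions-complete (suc n) {zero ∷ c}  (() ∷ _) _
  compositions-complete (suc n) {suc zero ∷ []} _ eq =
    ∈-concatMap⁺ grow (Any.map (λ { refl → here refl })
      (compositions-complete n {[]} [] (suc-injective eq)))
  compositions-complete (suc n) {suc zero ∷ x ∷ c} (_ ∷ ps) eq =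
    ∈-concatMap⁺ grow (Any.map (λ { refl → here refl })
      (compositions-complete n ps (suc-injective eq)))
  compositions-complete (suc n) {suc (suc x) ∷ c} (_ ∷ ps) eq =
    ∈-concatMap⁺ grow (Any.map (λ { refl → there (here refl) })
      (compositions-complete n {suc x ∷ c} (z<s ∷ ps) (suc-injective eq)))

  concatMap-grow-unique : ∀ {cs} → All Positive cs → Unique cs → Unique (concatMap grow cs)
  concatMap-grow-unique pos uniq = Unique.concat⁺
    (All.map⁺ (All.map (grow-unique _) pos))
    (AllPairs.map⁺ (disjoint pos uniq))
    where
    disjoint : ∀ {cs} → All Positive cs → Unique cs →
               AllPairs (λ c d → ∀ {x} → ¬ (x ∈ grow c × x ∈ grow d)) cs
    disjoint []       []       = []
    disjoint (p ∷ ps) (u ∷ us) =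
      All.zipWith (λ { (p′ , c≢d) (x∈ , x∈′) →
        c≢d (trans (sym (grow-shrink _ x∈ p)) (grow-shrink _ x∈′ p′)) }) (ps , u)
      ∷ disjoint ps us

  compositions-unique : ∀ n → Unique (compositions n)
  compositions-unique zero    = [] ∷ []
  compositions-unique (suc n) = concatMap-grow-unique
    (All.tabulate (proj₁ ∘ compositions-sound n)) (compositions-unique n)

partitions-sound : ∀ n {π} → π ∈ partitions n → IsPartition π × sum π ≡ n
partitions-sound n π∈ with ∈-filter⁻ isPartition? {xs = compositions n} π∈
... | c∈ , p = p , proj₂ (compositions-sound n c∈)

partitions-complete : ∀ n {π} → IsPartition π → sum π ≡ n → π ∈ partitions n
partitions-complete n p eq =
  ∈-filter⁺ isPartition? (compositions-complete n (IsPartition.positive p) eq) p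

partitions-unique : ∀ n → Unique (partitions n)
partitions-unique n = Unique.filter⁺ isPartition? (compositions-unique n)

{-# OPTIONS --safe #-}

-- Sorting the partitions in P_dom by their mex 2m+1, and those in U_ic by
-- their least missing odd number 2j+1, turns the claim into
--
--   Σ_m q^{m(2m+1)} E_{2m+2} = Σ_j q^{j(3j+1)/2} (1 - q^{2j+1}) E_1,
--   E_m = (-q^m;q)_∞ / (q²;q²)_∞,
--
-- where E_1 = 1/(q;q)_∞ is Euler's theorem.  Let G(t,m) be the series
-- Σ_r (-1)^r q^{r(r-1)/2 + tr} E_{m+r}.  It satisfies
-- G(t,m) = E_m - q^t G(t+1,m+1) and, as E_m = (1 + q^m) E_{m+1},
-- also G(t,m) = G(t,m+1) + q^m G(t+1,m+1).  Hence
--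
--   G(2m+1,2m+1) = E_{2m+2} + q^{4m+3} G(2m+3,2m+3),
--   G(2k+1,k+1)  = (1 - q^{2k+1}) E_{k+1} + q^{3k+2} (1 + q^{k+1}) G(2k+3,k+2).
--
-- Iterating the first from m = 0 expands G(1,1) into the left-hand side;
-- iterating the second from k = 0, after multiplication by (-q;q)_k, expands
-- it into the right-hand side (this is Rogers' false theta identity).

module Submission where

open import Data.Nat.Base using (ℕ; zero; suc; _+_; _*_; _^_; _≤_; _<_; _≥_; z≤n; s≤s; z<s; s≤s⁻¹; >-nonZero)
open import Data.Nat.Properties
open import Data.Bool.Base using (true; false; if_then_else_)
open import Data.Nat.Divisibility using (_∣_; divides; m∣m*n; ∣⇒≤; ∣1⇒≡1; ∣m+n∣m⇒∣n)
open import Data.Nat.ListAction using (sum)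
open import Data.Nat.ListAction.Properties using (sum-++; sum-↭)
open import Data.List.Base using (List; []; _∷_; map; filter; concatMap; length; deduplicate; replicate; _++_; upTo; downFrom; applyUpTo)
open import Data.List.Properties using (map-++; filter-accept; filter-reject; length-++; length-replicate; ++-cancelˡ; map-applyUpTo)
open import Data.List.Membership.Propositional using (_∈_; _∉_; find; lose)
open import Data.List.Membership.Propositional.Properties
open import Data.List.Relation.Unary.All using (All; []; _∷_)
import Data.List.Relation.Unary.All as All
import Data.List.Relation.Unary.All.Properties as All
open import Data.List.Relation.Unary.Any using (here; there)
open import Data.List.Relation.Unary.AllPairs using (AllPairs; []; _∷_)
import Data.List.Relation.Unary.AllPairs as AllPairs
import Data.List.Relation.Unary.AllPairs.Properties as AllPairs
open import Data.List.Relation.Unary.Linked using (Linked; []; [-]; _∷_)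
import Data.List.Relation.Unary.Linked as Linked
import Data.List.Relation.Unary.Linked.Properties as Linked
open import Data.List.Relation.Unary.Unique.Propositional using (Unique)
import Data.List.Relation.Unary.Unique.Propositional.Properties as Unique
import Data.List.Relation.Unary.Unique.DecPropositional.Properties as DecUnique
open import Data.List.Relation.Binary.Permutation.Propositional using (_↭_)
open import Data.List.Relation.Binary.Permutation.Propositional.Properties using (map⁺; ↭-length)
open import Data.List.Relation.Binary.BagAndSetEquality using (∼bag⇒↭)
open import Data.List.Membership.Propositional.Properties.WithK using (unique∧set⇒bag)
open import Data.Product.Base using (_×_; _,_; proj₁; proj₂; ∃; ∃₂)
open import Data.Sum.Base using (_⊎_; inj₁; inj₂)
open import Function.Base using (_∘_; _$_)
open import Function.Bundles using (mk⇔)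
open import Level using (0ℓ)
open import Relation.Unary using (Pred; Decidable)
open import Relation.Binary.PropositionalEquality using (_≡_; _≢_; _≗_; refl; sym; trans; cong; cong₂; subst; module ≡-Reasoning)
open import Relation.Nullary using (¬_; Dec; yes; no; does; contradiction; _×-dec_)
open import Relation.Binary.Definitions using (tri<; tri≈; tri>)
open import Defs
import Algebra.Properties.CommutativeSemigroup +-commutativeSemigroup as ℕ+
open import Data.Integer.Base as ℤ using (ℤ; 0ℤ) renaming (+_ to pos)
import Data.Integer.Properties as ℤ
import Data.Integer.Tactic.RingSolver as ℤ-Ring
open import Data.Nat.Induction using (<-rec)
import Data.Nat.Tactic.RingSolver as ℕ-Ring
open import Relation.Nullary.Decidable using (decidable-stable)

-- Everything is stated for a single coefficient of q^n, so infinite sums and products are finite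
-- truncations, which agree for all bounds beyond n. Series are never divided: a factor such as 1/(1
-- - q^i) is a weight function on the multiplicity of the part i, and an identity between quotients
-- becomes a recursion behind a positive power of q, which has only one solution. Signs occur only
-- in the recursions for G, so ℤ is confined to them; both final expansions have natural
-- coefficients and are compared in ℕ. The exponents are sizes of compulsory parts. A partition in
-- P_dom with mex 2m+1 contains 1, ..., 2m, of sum m(2m+1). One in U_ic with least missing odd
-- number 2j+1 contains 1, 3, ..., 2j-1 and, on top of these, another copy of the odd and one copy
-- of the even numbers up to j, of total j^2 + j(j+1)/2 = j(3j+1)/2. Once these copies are taken
-- off, the conditions on the multiplicities of different parts are independent, so the series is a
-- product.

-- Finite sums and multiplication by powers of q

Σ< : ℕ → (ℕ → ℕ) → ℕ
Σ< zero    f = 0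
Σ< (suc n) f = f 0 + Σ< n (f ∘ suc)

Σ<-cong : ∀ n {f g : ℕ → ℕ} → (∀ {m} → m < n → f m ≡ g m) → Σ< n f ≡ Σ< n g
Σ<-cong zero    eq = refl
Σ<-cong (suc n) eq = cong₂ _+_ (eq z<s) (Σ<-cong n (eq ∘ s≤s))

Σ<-zero : ∀ n {f : ℕ → ℕ} → (∀ {m} → m < n → f m ≡ 0) → Σ< n f ≡ 0
Σ<-zero zero    eq = refl
Σ<-zero (suc n) eq = cong₂ _+_ (eq z<s) (Σ<-zero n (eq ∘ s≤s))

Σ<-+ : ∀ n (f g : ℕ → ℕ) → Σ< n (λ m → f m + g m) ≡ Σ< n f + Σ< n g
Σ<-+ zero    f g = refl
Σ<-+ (suc n) f g = trans (cong (f 0 + g 0 +_) (Σ<-+ n _ _)) (ℕ+.interchange (f 0) (g 0) _ _)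

Σ<-extend : ∀ {k n} {f : ℕ → ℕ} → k ≤ n → (∀ {m} → k ≤ m → f m ≡ 0) → Σ< n f ≡ Σ< k f
Σ<-extend {n = n} z≤n       eq = Σ<-zero n (λ _ → eq z≤n)
Σ<-extend         (s≤s k≤n) eq = cong (_ +_) (Σ<-extend k≤n (eq ∘ s≤s))

Σ<-last : ∀ n f → Σ< (suc n) f ≡ Σ< n f + f n
Σ<-last zero    f = +-identityʳ (f 0)
Σ<-last (suc n) f = trans (cong (f 0 +_) (Σ<-last n (f ∘ suc))) (sym (+-assoc (f 0) _ _))

Σ<-≥ : ∀ {d} n → (∀ k → 0 < d k) → n ≤ Σ< n d
Σ<-≥ zero    0<d = z≤n
Σ<-≥ (suc n) 0<d = +-mono-≤ (0<d 0) (Σ<-≥ n (0<d ∘ suc))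

-- Multiplication of a series by q^a, over a coefficient type with zero z.
module Shift {A : Set} (z : A) where

  shift : ℕ → (ℕ → A) → ℕ → A
  shift zero    f n       = f n
  shift (suc a) f zero    = z
  shift (suc a) f (suc n) = shift a f n

  -- Coefficient n of q^a f sees only coefficients up to n - a of f. For a > 0 this is what makes
  -- induction on the coefficient possible in all recursions below.
  shift-cong≤ : ∀ a {f g n} → (∀ {k} → k + a ≤ n → f k ≡ g k) → shift a f n ≡ shift a g n
  shift-cong≤ zero    {n = n}     eq = eq (≤-reflexive (+-identityʳ n))
  shift-cong≤ (suc a) {n = zero}  eq = refl
  shift-cong≤ (suc a) {n = suc n} eq = shift-cong≤ a λ {k} k+a≤n → eq (≤-trans (≤-reflexive (+-suc k a)) (s≤s k+a≤n))

  shift-cong : ∀ a {f g} → f ≗ g → shift a f ≗ shift a g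
  shift-cong a eq _ = shift-cong≤ a λ _ → eq _

  shift-> : ∀ {a n} f → n < a → shift a f n ≡ z
  shift-> {suc a} {zero}  f _         = refl
  shift-> {suc a} {suc n} f (s≤s n<a) = shift-> f n<a

  shift-shift : ∀ a b f → shift a (shift b f) ≗ shift (a + b) f
  shift-shift zero    b f n       = refl
  shift-shift (suc a) b f zero    = refl
  shift-shift (suc a) b f (suc n) = shift-shift a b f n

  shift-comm : ∀ a b f → shift a (shift b f) ≗ shift b (shift a f)
  shift-comm a b f n = begin
    shift a (shift b f) n ≡⟨ shift-shift a b f n ⟩
    shift (a + b) f n     ≡⟨ cong (λ c → shift c f n) (+-comm a b) ⟩
    shift (b + a) f n     ≡⟨ shift-shift b a f n ⟨
    shift b (shift a f) n ∎
    where open ≡-Reasoning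

  shift-op₂ : ∀ (_∙_ : A → A → A) → z ∙ z ≡ z → ∀ a f g →
              shift a (λ n → f n ∙ g n) ≗ λ n → shift a f n ∙ shift a g n
  shift-op₂ _∙_ eq zero    f g n       = refl
  shift-op₂ _∙_ eq (suc a) f g zero    = sym eq
  shift-op₂ _∙_ eq (suc a) f g (suc n) = shift-op₂ _∙_ eq a f g n

-- Padding with zeros commutes with any map that preserves zero: the embedding `pos`, scaling by a
-- constant, the zero map.
shift-map : ∀ {A B : Set} {y : A} {z : B} (h : A → B) → h y ≡ z → ∀ a f →
            Shift.shift z a (h ∘ f) ≗ h ∘ Shift.shift y a f
shift-map h eq zero    f n       = refl
shift-map h eq (suc a) f zero    = sym eq
shift-map h eq (suc a) f (suc n) = shift-map h eq a f n

-- The two recursions for G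

module FalseTheta (e : ℕ → ℕ → ℤ)
  (e-rec : ∀ {m} → 0 < m → ∀ n → e m n ≡ e (suc m) n ℤ.+ Shift.shift 0ℤ m (e (suc m)) n) where

  open Shift 0ℤ

  shift-+ℤ : ∀ a f g → shift a (λ n → f n ℤ.+ g n) ≗ λ n → shift a f n ℤ.+ shift a g n
  shift-+ℤ = shift-op₂ ℤ._+_ refl

  shift-−ℤ : ∀ a f g → shift a (λ n → f n ℤ.- g n) ≗ λ n → shift a f n ℤ.- shift a g n
  shift-−ℤ = shift-op₂ ℤ._-_ refl

  shift-≡ : ∀ {a b} f → a ≡ b → shift a f ≗ shift b f
  shift-≡ f eq n = cong (λ c → shift c f n) eq

  -- G t m = Σ_r (-1)^r q^{r(r-1)/2 + (t+1)r} e_{m+r}; the first argument of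
  -- truncatedG bounds r.
  truncatedG : ℕ → ℕ → ℕ → ℕ → ℤ
  truncatedG zero    t m n = 0ℤ
  truncatedG (suc B) t m n = e m n ℤ.- shift (suc t) (truncatedG B (suc t) (suc m)) n

  G : ℕ → ℕ → ℕ → ℤ
  G t m n = truncatedG (suc n) t m n

  -- Each unfolding stands behind a positive power of q, so the r-th term starts in degree at least
  -- r and the terms with r ≤ n settle coefficient n.
  truncatedG-stable : ∀ {B B′ n} t m → n < B → n < B′ → truncatedG B t m n ≡ truncatedG B′ t m n
  truncatedG-stable {suc B} {suc B′} {n} t m (s≤s n≤B) (s≤s n≤B′) = cong (ℤ._-_ (e m n)) $
    shift-cong≤ (suc t) λ {k} le →
      let k<n = ≤-trans (m<m+n k z<s) le in
      truncatedG-stable (suc t) (suc m) (≤-trans k<n n≤B) (≤-trans k<n n≤B′)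

  G-rec : ∀ t m n → G t m n ≡ e m n ℤ.- shift (suc t) (G (suc t) (suc m)) n
  G-rec t m n = cong (ℤ._-_ (e m n)) $ shift-cong≤ (suc t) {n = n} λ {k} le →
    truncatedG-stable (suc t) (suc m) (≤-trans (m<m+n k z<s) le) (n<1+n k)

  -- Termwise this is e_{m+r} = (1 + q^{m+r}) e_{m+r+1}: of the factor q^{m+r}, the part q^m comes
  -- out of the sum and q^r raises t by one. As the sum is infinite, the proof is by strong
  -- induction on the coefficient, the induction hypothesis being used behind q^{t+1}.
  G-suc : ∀ n t {m} → 0 < m → G t m n ≡ G t (suc m) n ℤ.+ shift m (G (suc t) (suc m)) n
  G-suc = <-rec _ λ n rec t {m} 0<m → begin
    G t m n
      ≡⟨ G-rec t m n ⟩
    e m n ℤ.- shift (suc t) (G (suc t) (suc m)) n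
      ≡⟨ cong₂ ℤ._-_ (e-rec 0<m n) (trans
           (shift-cong≤ (suc t) λ {k} le → rec (≤-trans (m<m+n k z<s) le) (suc t) z<s)
           (shift-+ℤ (suc t) (G (suc t) (2 + m)) (shift (suc m) (G (2 + t) (2 + m))) n)) ⟩
    (e (suc m) n ℤ.+ shift m (e (suc m)) n) ℤ.-
      (shift (suc t) (G (suc t) (2 + m)) n ℤ.+ shift (suc t) (shift (suc m) (G (2 + t) (2 + m))) n)
      ≡⟨ cong (λ x → (e (suc m) n ℤ.+ shift m (e (suc m)) n) ℤ.- (shift (suc t) (G (suc t) (2 + m)) n ℤ.+ x))
           (trans (shift-shift (suc t) (suc m) _ n) (trans
             (shift-≡ (G (2 + t) (2 + m)) (exp≡ t m) n) (sym (shift-shift m (2 + t) _ n)))) ⟩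
    (e (suc m) n ℤ.+ shift m (e (suc m)) n) ℤ.-
      (shift (suc t) (G (suc t) (2 + m)) n ℤ.+ shift m (shift (2 + t) (G (2 + t) (2 + m))) n)
      ≡⟨ regroup (e (suc m) n) (shift m (e (suc m)) n) _ _ ⟩
    (e (suc m) n ℤ.- shift (suc t) (G (suc t) (2 + m)) n) ℤ.+
      (shift m (e (suc m)) n ℤ.- shift m (shift (2 + t) (G (2 + t) (2 + m))) n)
      ≡⟨ cong₂ ℤ._+_ (G-rec t (suc m) n) (trans (shift-cong m (G-rec (suc t) (suc m)) n)
           (shift-−ℤ m (e (suc m)) (shift (2 + t) (G (2 + t) (2 + m))) n)) ⟨
    G t (suc m) n ℤ.+ shift m (G (suc t) (suc m)) n ∎
    where
    open ≡-Reasoning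
    exp≡ : ∀ t m → suc t + suc m ≡ m + (2 + t)
    exp≡ = ℕ-Ring.solve-∀
    regroup : ∀ w x y z → (w ℤ.+ x) ℤ.- (y ℤ.+ z) ≡ (w ℤ.- y) ℤ.+ (x ℤ.- z)
    regroup = ℤ-Ring.solve-∀

  module Step (k : ℕ) where
    open ≡-Reasoning
    a b c : ℕ
    a = suc k
    b = suc (2 * k)
    c = 2 + 3 * k
    H₀ H₁ H₁+ G′ G″ : ℕ → ℤ
    H₀ = G (2 * k) a
    H₁ = G (2 + 2 * k) (suc a)
    G′ = G (2 + 2 * k) (2 + a)
    G″ = G (3 + 2 * k) (2 + a)
    H₁+ n = H₁ n ℤ.+ shift a H₁ n

    -- The first copy of `H₁` is expanded by `G-rec`, the second by `G-suc`. Both produce q^{2k+3}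
    -- `G″`, with opposite signs.
    H₁+≡ : ∀ n → H₁+ n ≡ e (suc a) n ℤ.+ shift a G′ n
    H₁+≡ n = begin
      H₁ n ℤ.+ shift a H₁ n
        ≡⟨ cong₂ ℤ._+_ (G-rec (2 + 2 * k) (suc a) n) (trans
             (shift-cong a (λ m → G-suc m (2 + 2 * k) z<s) n)
             (shift-+ℤ a G′ (shift (suc a) G″) n)) ⟩
      (e (suc a) n ℤ.- shift (3 + 2 * k) G″ n) ℤ.+ (shift a G′ n ℤ.+ shift a (shift (suc a) G″) n)
        ≡⟨ cong (λ x → (e (suc a) n ℤ.- shift (3 + 2 * k) G″ n) ℤ.+ (shift a G′ n ℤ.+ x))
             (trans (shift-shift a (suc a) G″ n) (shift-≡ G″ (exp≡ k) n)) ⟩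
      (e (suc a) n ℤ.- shift (3 + 2 * k) G″ n) ℤ.+ (shift a G′ n ℤ.+ shift (3 + 2 * k) G″ n)
        ≡⟨ cancel (e (suc a) n) (shift (3 + 2 * k) G″ n) (shift a G′ n) ⟩
      e (suc a) n ℤ.+ shift a G′ n ∎
      where
      exp≡ : ∀ k → suc k + suc (suc k) ≡ 3 + 2 * k
      exp≡ = ℕ-Ring.solve-∀
      cancel : ∀ x y z → (x ℤ.- y) ℤ.+ (z ℤ.+ y) ≡ x ℤ.+ z
      cancel = ℤ-Ring.solve-∀

    -- Since 2k+2 is twice k+1, adding and subtracting q^{k+1} e_{k+2} completes e_{k+2} to e_{k+1}
    -- and leaves -q^{k+1} times the right-hand side of `H₁+≡`.
    middle : ∀ n → G b (suc a) n ≡ e a n ℤ.- shift a H₁+ n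
    middle n = begin
      G b (suc a) n
        ≡⟨ G-rec b (suc a) n ⟩
      e (suc a) n ℤ.- shift (suc b) G′ n
        ≡⟨ cong (ℤ._-_ (e (suc a) n)) (trans (shift-shift a a G′ n) (shift-≡ G′ (exp≡ k) n)) ⟨
      e (suc a) n ℤ.- shift a (shift a G′) n
        ≡⟨ cancel (e (suc a) n) (shift a (e (suc a)) n) (shift a (shift a G′) n) ⟨
      (e (suc a) n ℤ.+ shift a (e (suc a)) n) ℤ.- (shift a (e (suc a)) n ℤ.+ shift a (shift a G′) n)
        ≡⟨ cong₂ ℤ._-_ (e-rec z<s n) (trans (shift-cong a H₁+≡ n) (shift-+ℤ a (e (suc a)) (shift a G′) n)) ⟨
      e a n ℤ.- shift a H₁+ n ∎
      where
      exp≡ : ∀ k → suc k + suc k ≡ 2 + 2 * k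
      exp≡ = ℕ-Ring.solve-∀
      cancel : ∀ x y z → (x ℤ.+ y) ℤ.- (y ℤ.+ z) ≡ x ℤ.- z
      cancel = ℤ-Ring.solve-∀

    H-step : ∀ n → H₀ n ≡ (e a n ℤ.- shift b (e a) n) ℤ.+ shift c H₁+ n
    H-step n = begin
      H₀ n
        ≡⟨ G-rec (2 * k) a n ⟩
      e a n ℤ.- shift b (G b (suc a)) n
        ≡⟨ cong (ℤ._-_ (e a n)) (trans (shift-cong b middle n) (shift-−ℤ b (e a) (shift a H₁+) n)) ⟩
      e a n ℤ.- (shift b (e a) n ℤ.- shift b (shift a H₁+) n)
        ≡⟨ cong (λ x → e a n ℤ.- (shift b (e a) n ℤ.- x))
             (trans (shift-shift b a H₁+ n) (shift-≡ H₁+ (exp≡ k) n)) ⟩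
      e a n ℤ.- (shift b (e a) n ℤ.- shift c H₁+ n)
        ≡⟨ regroup (e a n) _ _ ⟩
      (e a n ℤ.- shift b (e a) n) ℤ.+ shift c H₁+ n ∎
      where
      exp≡ : ∀ k → suc (2 * k) + suc k ≡ 2 + 3 * k
      exp≡ = ℕ-Ring.solve-∀
      regroup : ∀ x y z → x ℤ.- (y ℤ.- z) ≡ (x ℤ.- y) ℤ.+ z
      regroup = ℤ-Ring.solve-∀

  -- Multiplication by (-q;q)_k.
  op : ℕ → (ℕ → ℤ) → ℕ → ℤ
  op zero    f = f
  op (suc k) f = op k λ n → f n ℤ.+ shift (suc k) f n

  op-cong : ∀ k {f g} → f ≗ g → op k f ≗ op k g
  op-cong zero    eq = eq
  op-cong (suc k) eq = op-cong k λ n → cong₂ ℤ._+_ (eq n) (shift-cong (suc k) eq n)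

  -- The interchange law is what one factor 1 + q^k requires of the operation; it holds for sums and
  -- for differences.
  op-linear : ∀ k (_∙_ : ℤ → ℤ → ℤ) → 0ℤ ∙ 0ℤ ≡ 0ℤ →
              (∀ w x y z → (w ∙ x) ℤ.+ (y ∙ z) ≡ (w ℤ.+ y) ∙ (x ℤ.+ z)) →
              ∀ f g → op k (λ n → f n ∙ g n) ≗ λ n → op k f n ∙ op k g n
  op-linear zero    _∙_ eq inter f g n = refl
  op-linear (suc k) _∙_ eq inter f g n = trans
    (op-cong k (λ m → trans (cong (ℤ._+_ (f m ∙ g m)) (shift-op₂ _∙_ eq (suc k) f g m)) (inter (f m) (g m) _ _)) n)
    (op-linear k _∙_ eq inter (λ m → f m ℤ.+ shift (suc k) f m) (λ m → g m ℤ.+ shift (suc k) g m) n)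

  op-+ : ∀ k f g → op k (λ n → f n ℤ.+ g n) ≗ λ n → op k f n ℤ.+ op k g n
  op-+ k = op-linear k ℤ._+_ refl ℤ-Ring.solve-∀

  op-− : ∀ k f g → op k (λ n → f n ℤ.- g n) ≗ λ n → op k f n ℤ.- op k g n
  op-− k = op-linear k ℤ._-_ refl ℤ-Ring.solve-∀

  op-shift : ∀ k a f → op k (shift a f) ≗ shift a (op k f)
  op-shift zero    a f n = refl
  op-shift (suc k) a f n = trans
    (op-cong k (λ m → trans (cong (ℤ._+_ (shift a f m)) (shift-comm (suc k) a f m))
                        (sym (shift-+ℤ a f (shift (suc k) f) m))) n)
    (op-shift k a _ n)

  -- The factor 1 + q^i carries e_{i+1} to e_i. This is why `op` applies its largest factor first.
  op-e : ∀ k → op k (e (suc k)) ≗ e 1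
  op-e zero    n = refl
  op-e (suc k) n = trans (op-cong k (λ m → sym (e-rec z<s m)) n) (op-e k n)

  H : ℕ → ℕ → ℤ
  H k = G (2 * k) (suc k)

  -- Multiplication by (-q;q)_k makes the head of `H-step` a multiple of e_1 for every k, and the
  -- factor 1 + q^{k+1} of its tail turns (-q;q)_k into (-q;q)_{k+1}, so the step can be iterated.
  opH-step : ∀ k n → op k (H k) n ≡
             (e 1 n ℤ.- shift (suc (2 * k)) (e 1) n) ℤ.+ shift (2 + 3 * k) (op (suc k) (H (suc k))) n
  opH-step k n = begin
    op k (H k) n
      ≡⟨ op-cong k (λ m → trans (H-step m)
           (cong (λ x → (e a m ℤ.- shift b (e a) m) ℤ.+ x) (shift-cong c H₁+≗ m))) n ⟩
    op k (λ m → (e a m ℤ.- shift b (e a) m) ℤ.+ shift c Hsuc+ m) n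
      ≡⟨ op-+ k (λ m → e a m ℤ.- shift b (e a) m) (shift c Hsuc+) n ⟩
    op k (λ m → e a m ℤ.- shift b (e a) m) n ℤ.+ op k (shift c Hsuc+) n
      ≡⟨ cong₂ ℤ._+_ (op-− k (e a) (shift b (e a)) n) (op-shift k c Hsuc+ n) ⟩
    (op k (e a) n ℤ.- op k (shift b (e a)) n) ℤ.+ shift c (op k Hsuc+) n
      ≡⟨ cong (λ x → x ℤ.+ shift c (op k Hsuc+) n) (cong₂ ℤ._-_ (op-e k n)
           (trans (op-shift k b (e a) n) (shift-cong b (op-e k) n))) ⟩
    (e 1 n ℤ.- shift b (e 1) n) ℤ.+ shift c (op k Hsuc+) n ∎
    where
    open ≡-Reasoning
    open Step k
    Hsuc+ : ℕ → ℤ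
    Hsuc+ m = H (suc k) m ℤ.+ shift (suc k) (H (suc k)) m
    H₁≗ : H₁ ≗ H (suc k)
    H₁≗ m = cong (λ t → G t (suc a) m) (sym (*-suc 2 k))
    H₁+≗ : H₁+ ≗ Hsuc+
    H₁+≗ m = cong₂ ℤ._+_ (H₁≗ m) (shift-cong a H₁≗ m)

  diagonal : ℕ → ℕ → ℤ
  diagonal m = G (2 * m) (suc (2 * m))

  -- On the diagonal, the power q^{2m+1} in `G-rec` is also the one in `e-rec`. Hence the negative
  -- term of the first unfolding cancels against e_{2m+1} - e_{2m+2}, and the second unfolding
  -- restores a positive sign.
  diagonal-step : ∀ m n → diagonal m n ≡ e (2 * suc m) n ℤ.+ shift (3 + 4 * m) (diagonal (suc m)) n
  diagonal-step m n rewrite *-suc 2 m = begin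
    G (2 * m) a n
      ≡⟨ G-rec (2 * m) a n ⟩
    e a n ℤ.- shift a (G a b) n
      ≡⟨ cong₂ ℤ._-_ (e-rec z<s n) (trans (shift-cong a (G-rec a b) n) (shift-−ℤ a (e b) (shift b (G b (suc b))) n)) ⟩
    (e b n ℤ.+ shift a (e b) n) ℤ.- (shift a (e b) n ℤ.- shift a (shift b (G b (suc b))) n)
      ≡⟨ cancel (e b n) (shift a (e b) n) _ ⟩
    e b n ℤ.+ shift a (shift b (G b (suc b))) n
      ≡⟨ cong (ℤ._+_ (e b n)) (trans (shift-shift a b _ n) (shift-≡ (G b (suc b)) (exp≡ m) n)) ⟩
    e b n ℤ.+ shift (3 + 4 * m) (G b (suc b)) n ∎
    where
    open ≡-Reasoning
    a b : ℕ
    a = suc (2 * m)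
    b = 2 + 2 * m
    exp≡ : ∀ m → suc (2 * m) + (2 + 2 * m) ≡ 3 + 4 * m
    exp≡ = ℕ-Ring.solve-∀
    cancel : ∀ x y z → (x ℤ.+ y) ℤ.- (y ℤ.- z) ≡ x ℤ.+ z
    cancel = ℤ-Ring.solve-∀

  -- After M steps the remainder stands behind a power of q with exponent at least M, so it does not
  -- reach degree n < M. As the heads `A k` are natural, the expansion lies in the image of `pos`.
  iterate : ∀ (X : ℕ → ℕ → ℤ) (A : ℕ → ℕ → ℕ) d → (∀ k → 0 < d k) →
            (∀ k n → X k n ≡ pos (A k n) ℤ.+ shift (d k) (X (suc k)) n) →
            ∀ {M n} → n < M → X 0 n ≡ pos (Σ< M (λ k → Shift.shift 0 (Σ< k d) (A k) n))
  iterate X A d 0<d X-step {M} {n} n<M = begin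
    X 0 n                         ≡⟨ go M ⟩
    pos (S M) ℤ.+ shift (Σ< M d) (X M) n ≡⟨ cong (ℤ._+_ (pos (S M))) (shift-> (X M) (≤-trans n<M (Σ<-≥ M 0<d))) ⟩
    pos (S M) ℤ.+ 0ℤ                  ≡⟨ ℤ.+-identityʳ (pos (S M)) ⟩
    pos (S M)                         ∎
    where
    open ≡-Reasoning
    g : ℕ → ℕ
    g k = Shift.shift 0 (Σ< k d) (A k) n
    S : ℕ → ℕ
    S M = Σ< M g
    go : ∀ M → X 0 n ≡ pos (S M) ℤ.+ shift (Σ< M d) (X M) n
    go zero    = sym (ℤ.+-identityˡ (X 0 n))
    go (suc M) = begin
      X 0 n
        ≡⟨ go M ⟩
      pos (S M) ℤ.+ shift D (X M) n
        ≡⟨ cong (ℤ._+_ (pos (S M))) (trans (shift-cong D (X-step M) n) (shift-+ℤ D (λ m → pos (A M m)) (shift (d M) (X (suc M))) n)) ⟩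
      pos (S M) ℤ.+ (shift D (λ m → pos (A M m)) n ℤ.+ shift D (shift (d M) (X (suc M))) n)
        ≡⟨ cong₂ (λ x y → pos (S M) ℤ.+ (x ℤ.+ y)) (shift-map pos refl D (A M) n)
             (trans (shift-shift D (d M) _ n) (shift-≡ (X (suc M)) (sym (Σ<-last M d)) n)) ⟩
      pos (S M) ℤ.+ (pos (g M) ℤ.+ shift (Σ< (suc M) d) (X (suc M)) n)
        ≡⟨ ℤ.+-assoc (pos (S M)) (pos (g M)) (shift (Σ< (suc M) d) (X (suc M)) n) ⟨
      pos (S M + g M) ℤ.+ shift (Σ< (suc M) d) (X (suc M)) n
        ≡⟨ cong (λ x → pos x ℤ.+ shift (Σ< (suc M) d) (X (suc M)) n) (Σ<-last M g) ⟨
      pos (S (suc M)) ℤ.+ shift (Σ< (suc M) d) (X (suc M)) n ∎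
      where D = Σ< M d

-- Weighted partition series as products over part sizes

open Shift 0

shift-+ : ∀ a f g → shift a (λ n → f n + g n) ≗ λ n → shift a f n + shift a g n
shift-+ = shift-op₂ _+_ refl

shift-* : ∀ a c f → shift a (λ n → c * f n) ≗ λ n → c * shift a f n
shift-* a c f = shift-map (c *_) (*-zeroʳ c) a f

shift-Σ< : ∀ a B (g : ℕ → ℕ → ℕ) n →
           shift a (λ n → Σ< B (λ m → g m n)) n ≡ Σ< B (λ m → shift a (g m) n)
shift-Σ< a zero    g n = shift-map {y = 0} (λ _ → 0) refl a (λ _ → 0) n
shift-Σ< a (suc B) g n = trans (shift-+ a _ _ n) (cong (_ +_) (shift-Σ< a B (g ∘ suc) n))

-- mulAt i u is multiplication by Σ_m u(m) q^{m(i+1)}, the factor of a part of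
-- size i+1; mulUpTo B truncates the sum to m < B.
mulUpTo : ℕ → ℕ → (ℕ → ℕ) → (ℕ → ℕ) → ℕ → ℕ
mulUpTo B i u f n = Σ< B λ m → u m * shift (m * suc i) f n

mulAt : ℕ → (ℕ → ℕ) → (ℕ → ℕ) → ℕ → ℕ
mulAt i u f n = mulUpTo (suc n) i u f n

mulUpTo≡mulAt : ∀ {B} i u f {n} → n < B → mulUpTo B i u f n ≡ mulAt i u f n
mulUpTo≡mulAt i u f n<B = Σ<-extend n<B λ {m} n<m →
  trans (cong (u m *_) (shift-> f (≤-trans n<m (m≤m*n m (suc i))))) (*-zeroʳ (u m))

mulAt-cong : ∀ i {u v f g} n → u ≗ v → (∀ {k} → k ≤ n → f k ≡ g k) → mulAt i u f n ≡ mulAt i v g n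
mulAt-cong i n u≗v f≡g = Σ<-cong (suc n) λ {m} _ →
  cong₂ _*_ (u≗v m) (shift-cong≤ (m * suc i) λ {k} le → f≡g (m+n≤o⇒m≤o k le))

mulAt-+ˡ : ∀ i u v f → mulAt i (λ m → u m + v m) f ≗ λ n → mulAt i u f n + mulAt i v f n
mulAt-+ˡ i u v f n = trans
  (Σ<-cong (suc n) λ {m} _ → *-distribʳ-+ (shift (m * suc i) f n) (u m) (v m))
  (Σ<-+ (suc n) (λ m → u m * shift (m * suc i) f n) (λ m → v m * shift (m * suc i) f n))

mulAt-+ʳ : ∀ i u f g → mulAt i u (λ n → f n + g n) ≗ λ n → mulAt i u f n + mulAt i u g n
mulAt-+ʳ i u f g n = trans
  (Σ<-cong (suc n) λ {m} _ → trans
    (cong (u m *_) (shift-+ (m * suc i) f g n)) (*-distribˡ-+ (u m) (shift (m * suc i) f n) _))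
  (Σ<-+ (suc n) (λ m → u m * shift (m * suc i) f n) (λ m → u m * shift (m * suc i) g n))

mulAt-bound : ∀ a i u f n → shift a (mulUpTo (suc n) i u f) n ≡ shift a (mulAt i u f) n
mulAt-bound a i u f n = shift-cong≤ a λ {k} le → mulUpTo≡mulAt i u f (s≤s (m+n≤o⇒m≤o k le))

mulAt-shift : ∀ i u a f → mulAt i u (shift a f) ≗ shift a (mulAt i u f)
mulAt-shift i u a f n = begin
  mulUpTo (suc n) i u (shift a f) n
    ≡⟨ Σ<-cong (suc n) (λ {m} _ → trans
         (cong (u m *_) (shift-comm (m * suc i) a f n)) (sym (shift-* a (u m) _ n))) ⟩
  Σ< (suc n) (λ m → shift a (λ k → u m * shift (m * suc i) f k) n)
    ≡⟨ shift-Σ< a (suc n) (λ m k → u m * shift (m * suc i) f k) n ⟨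
  shift a (mulUpTo (suc n) i u f) n
    ≡⟨ mulAt-bound a i u f n ⟩
  shift a (mulAt i u f) n ∎
  where open ≡-Reasoning

mulAt-delay1 : ∀ i u f → mulAt i (shift 1 u) f ≗ shift (suc i) (mulAt i u f)
mulAt-delay1 i u f n = begin
  Σ< n (λ m → u m * shift (suc i + m * suc i) f n)
    -- Multiplicity 0 has weight zero after the delay, which leaves n terms; the term m = n restored
    -- here stands behind q^{(n+1)(i+1)} and vanishes.
    ≡⟨ Σ<-extend (n≤1+n n) (λ {m} n≤m → trans
         (cong (u m *_) (shift-> f (s≤s (≤-trans n≤m (≤-trans (m≤m*n m (suc i)) (m≤n+m _ i)))))) (*-zeroʳ (u m))) ⟨
  Σ< (suc n) (λ m → u m * shift (suc i + m * suc i) f n)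
    ≡⟨ Σ<-cong (suc n) (λ {m} _ → trans
         (cong (u m *_) (sym (shift-shift (suc i) (m * suc i) f n))) (sym (shift-* (suc i) (u m) _ n))) ⟩
  Σ< (suc n) (λ m → shift (suc i) (λ k → u m * shift (m * suc i) f k) n)
    ≡⟨ shift-Σ< (suc i) (suc n) (λ m k → u m * shift (m * suc i) f k) n ⟨
  shift (suc i) (mulUpTo (suc n) i u f) n
    ≡⟨ mulAt-bound (suc i) i u f n ⟩
  shift (suc i) (mulAt i u f) n ∎
  where open ≡-Reasoning

mulAt-delay : ∀ i a u f → mulAt i (shift a u) f ≗ shift (suc i * a) (mulAt i u f)
mulAt-delay i zero    u f n rewrite *-zeroʳ i = refl
mulAt-delay i (suc a) u f n = begin
  mulAt i (shift (suc a) u) f n                  ≡⟨ mulAt-cong i {shift (suc a) u} {shift 1 (shift a u)} {f} n (λ { zero → refl ; (suc _) → refl }) (λ _ → refl) ⟩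
  mulAt i (shift 1 (shift a u)) f n             ≡⟨ mulAt-delay1 i (shift a u) f n ⟩
  shift (suc i) (mulAt i (shift a u) f) n       ≡⟨ shift-cong (suc i) (mulAt-delay i a u f) n ⟩
  shift (suc i) (shift (suc i * a) (mulAt i u f)) n ≡⟨ shift-shift (suc i) (suc i * a) _ n ⟩
  shift (suc i + suc i * a) (mulAt i u f) n      ≡⟨ cong (λ c → shift c (mulAt i u f) n) (*-suc (suc i) a) ⟨
  shift (suc i * suc a) (mulAt i u f) n          ∎
  where open ≡-Reasoning

-- w i m is the weight of the part i occurring m times, and Z N w n the total
-- weight of the partitions of n into parts at most N.
Weights : Set
Weights = ℕ → ℕ → ℕ

Z : ℕ → Weights → ℕ → ℕ
Z zero    w zero    = 1
Z zero    w (suc n) = 0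
Z (suc N) w n       = mulAt N (w (suc N)) (Z N w) n

Z-cong : ∀ N {w v} → (∀ {i} → 0 < i → i ≤ N → w i ≗ v i) → Z N w ≗ Z N v
Z-cong zero    eq zero    = refl
Z-cong zero    eq (suc n) = refl
Z-cong (suc N) {w} {v} eq n = mulAt-cong N {w (suc N)} {v (suc N)} {Z N w} {Z N v} n
  (eq z<s ≤-refl) (λ {k} _ → Z-cong N (λ 0<i i≤N → eq 0<i (m≤n⇒m≤1+n i≤N)) k)

-- The size of the partition that has μ i copies of each part i ≤ N.
exponent : ℕ → (ℕ → ℕ) → ℕ
exponent zero    μ = 0
exponent (suc N) μ = suc N * μ (suc N) + exponent N μ

-- Delaying the weights of i by μ i makes that many copies compulsory. Taking them off everywhere
-- removes one fixed partition and costs a single power of q.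
Z-delay : ∀ N μ c → Z N (λ i → shift (μ i) (c i)) ≗ shift (exponent N μ) (Z N c)
Z-delay zero    μ c zero    = refl
Z-delay zero    μ c (suc n) = refl
Z-delay (suc N) μ c n = begin
  mulAt N (shift a u) (Z N (λ i → shift (μ i) (c i))) n
    ≡⟨ mulAt-cong N {shift a u} {shift a u} {f′} {shift b f} n (λ _ → refl) (λ {k} _ → Z-delay N μ c k) ⟩
  mulAt N (shift a u) (shift b f) n           ≡⟨ mulAt-delay N a u (shift b f) n ⟩
  shift (suc N * a) (mulAt N u (shift b f)) n ≡⟨ shift-cong (suc N * a) (mulAt-shift N u b f) n ⟩
  shift (suc N * a) (shift b (mulAt N u f)) n ≡⟨ shift-shift (suc N * a) b (mulAt N u f) n ⟩
  shift (suc N * a + b) (mulAt N u f) n       ∎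
  where
  open ≡-Reasoning
  a = μ (suc N)
  b = exponent N μ
  u = c (suc N)
  f = Z N c
  f′ = Z N (λ i → shift (μ i) (c i))

infixl 30 _[_≔_]
_[_≔_] : Weights → ℕ → (ℕ → ℕ) → Weights
(w [ i ≔ s ]) j with j ≟ i
... | yes _ = s
... | no  _ = w j

≔-same : ∀ w i s → (w [ i ≔ s ]) i ≡ s
≔-same w i s with i ≟ i
... | yes _  = refl
... | no i≢i = contradiction refl i≢i

≔-other : ∀ w {i j} s → j ≢ i → (w [ i ≔ s ]) j ≡ w j
≔-other w {i} {j} s j≢i with j ≟ i
... | yes j≡i = contradiction j≡i j≢i
... | no _    = refl

Z-≔-beyond : ∀ {N i} w s → N < i → Z N (w [ i ≔ s ]) ≗ Z N w
Z-≔-beyond {N} w s N<i = Z-cong N λ _ j≤N m →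
  cong (λ u → u m) (≔-other w s λ { refl → <⇒≱ N<i j≤N })

-- The product is linear in its factor at i, and one more compulsory copy of i costs q^i. The
-- functional equations of E_m and Euler's theorem come from this by choosing s and t.
Z-split : ∀ {N i} w {s t} → 0 < i → i ≤ N → (∀ m → w i m ≡ s m + shift 1 t m) →
          Z N w ≗ λ n → Z N (w [ i ≔ s ]) n + shift i (Z N (w [ i ≔ t ])) n
Z-split {zero}  w () z≤n eq
Z-split {suc N} {i} w {s} {t} 0<i i≤N eq n with m≤n⇒m<n∨m≡n i≤N
... | inj₂ refl = begin
  mulAt N (w i) f n
    ≡⟨ mulAt-cong N {w i} {λ m → s m + shift 1 t m} {f} {f} n eq (λ _ → refl) ⟩
  mulAt N (λ m → s m + shift 1 t m) f n
    ≡⟨ mulAt-+ˡ N s (shift 1 t) f n ⟩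
  mulAt N s f n + mulAt N (shift 1 t) f n
    ≡⟨ cong (mulAt N s f n +_) (mulAt-delay1 N t f n) ⟩
  mulAt N s f n + shift i (mulAt N t f) n
    ≡⟨ cong₂ _+_ (at s n) (shift-cong i (at t) n) ⟩
  Z i (w [ i ≔ s ]) n + shift i (Z i (w [ i ≔ t ])) n ∎
  where
  open ≡-Reasoning
  f = Z N w
  at : ∀ r k → mulAt N r f k ≡ Z i (w [ i ≔ r ]) k
  at r k = mulAt-cong N {r} {(w [ i ≔ r ]) i} {f} {Z N (w [ i ≔ r ])} k
    (λ m → cong (λ u → u m) (sym (≔-same w i r))) (λ {l} _ → sym (Z-≔-beyond w r (n<1+n N) l))
... | inj₁ (s≤s i≤N′) = begin
  mulAt N u (Z N w) n
    ≡⟨ mulAt-cong N {u} {u} {Z N w} {λ k → g k + shift i h k} n (λ _ → refl) (λ {k} _ → Z-split w 0<i i≤N′ eq k) ⟩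
  mulAt N u (λ k → g k + shift i h k) n
    ≡⟨ mulAt-+ʳ N u g (shift i h) n ⟩
  mulAt N u g n + mulAt N u (shift i h) n
    ≡⟨ cong (mulAt N u g n +_) (mulAt-shift N u i h n) ⟩
  mulAt N u g n + shift i (mulAt N u h) n
    ≡⟨ cong₂ _+_ (at s n) (shift-cong i (at t) n) ⟩
  Z (suc N) (w [ i ≔ s ]) n + shift i (Z (suc N) (w [ i ≔ t ])) n ∎
  where
  open ≡-Reasoning
  u = w (suc N)
  g = Z N (w [ i ≔ s ])
  h = Z N (w [ i ≔ t ])
  at : ∀ r k → mulAt N u (Z N (w [ i ≔ r ])) k ≡ Z (suc N) (w [ i ≔ r ]) k
  at r k = cong (λ v → mulAt N v (Z N (w [ i ≔ r ])) k)
    (sym (≔-other w {i} {suc N} r λ { refl → <⇒≱ (n<1+n N) i≤N′ }))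

-- Factors with constant term 1 make the infinite product meaningful: parts larger than n leave
-- coefficient n unchanged, so `Z∞` may stop at n.
Normalised : Weights → Set
Normalised w = ∀ i → w i 0 ≡ 1

≔-normalised : ∀ w i s → Normalised w → s 0 ≡ 1 → Normalised (w [ i ≔ s ])
≔-normalised w i s w₀ s₀ j with j ≟ i
... | yes _ = s₀
... | no  _ = w₀ j

Z∞ : Weights → ℕ → ℕ
Z∞ w n = Z n w n

Z-suc : ∀ {N n} w → Normalised w → n ≤ N → Z (suc N) w n ≡ Z N w n
Z-suc {N} {n} w w₀ n≤N = begin
  Σ< (suc n) g       ≡⟨ Σ<-extend {1} {suc n} {g} (s≤s z≤n) (λ { {suc m} _ → trans
                          (cong (w (suc N) (suc m) *_) (shift-> {suc m * suc N} (Z N w) (s≤s (≤-trans n≤N (m≤m+n N _)))))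
                          (*-zeroʳ (w (suc N) (suc m))) }) ⟩
  g 0 + 0            ≡⟨ +-identityʳ _ ⟩
  w (suc N) 0 * Z N w n ≡⟨ cong (_* Z N w n) (w₀ (suc N)) ⟩
  1 * Z N w n        ≡⟨ *-identityˡ _ ⟩
  Z N w n            ∎
  where
  open ≡-Reasoning
  g : ℕ → ℕ
  g m = w (suc N) m * shift (m * suc N) (Z N w) n

Z≡Z∞ : ∀ {N n} w → Normalised w → n ≤ N → Z N w n ≡ Z∞ w n
Z≡Z∞ {zero}  w w₀ z≤n = refl
Z≡Z∞ {suc N} w w₀ n≤N with m≤n⇒m<n∨m≡n n≤N
... | inj₂ refl       = refl
... | inj₁ (s≤s n≤N′) = trans (Z-suc w w₀ n≤N′) (Z≡Z∞ w w₀ n≤N′)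

Z∞-cong : ∀ {w v} → (∀ {i} → 0 < i → w i ≗ v i) → Z∞ w ≗ Z∞ v
Z∞-cong eq n = Z-cong n (λ 0<i _ → eq 0<i) n

Z∞-split : ∀ w {i} s t → Normalised w → s 0 ≡ 1 → t 0 ≡ 1 → 0 < i → (∀ m → w i m ≡ s m + shift 1 t m) →
           Z∞ w ≗ λ n → Z∞ (w [ i ≔ s ]) n + shift i (Z∞ (w [ i ≔ t ])) n
Z∞-split w {i} s t w₀ s₀ t₀ 0<i eq n = begin
  -- The bound n + i is at least i, as `Z-split` demands, and at least n, so that nothing is cut
  -- off.
  Z∞ w n       ≡⟨ Z≡Z∞ w w₀ (m≤m+n n i) ⟨
  Z (n + i) w n ≡⟨ Z-split w 0<i (m≤n+m i n) eq n ⟩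
  Z (n + i) (w [ i ≔ s ]) n + shift i (Z (n + i) (w [ i ≔ t ])) n
    ≡⟨ cong₂ _+_ (Z≡Z∞ _ (≔-normalised w i s w₀ s₀) (m≤m+n n i))
         (shift-cong≤ i λ {k} le → Z≡Z∞ _ (≔-normalised w i t w₀ t₀) (≤-trans (m+n≤o⇒m≤o k le) (m≤m+n n i))) ⟩
  Z∞ (w [ i ≔ s ]) n + shift i (Z∞ (w [ i ≔ t ])) n ∎
  where open ≡-Reasoning

-- The series E_m and Euler's theorem

-- As weights of a part i these are the factors 1/(1 - q^i), 1, 1 + q^i and (1 + q^i)/(1 - q^i), the
-- last being that of overpartitions.
one nil dist over : ℕ → ℕ
one  _             = 1
nil  zero          = 1
nil  (suc _)       = 0
dist zero          = 1
dist (suc zero)    = 1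
dist (suc (suc _)) = 0
over zero          = 1
over (suc _)       = 2

-- ε m has generating function E_m = (-q^m;q)_∞ / (q²;q²)_∞.
ε : ℕ → Weights
ε m i with i <? m | even? i
... | yes _ | yes _ = one
... | yes _ | no  _ = nil
... | no  _ | yes _ = over
... | no  _ | no  _ = dist

ε-normalised : ∀ m → Normalised (ε m)
ε-normalised m i with i <? m | even? i
... | yes _ | yes _ = refl
... | yes _ | no  _ = refl
... | no  _ | yes _ = refl
... | no  _ | no  _ = refl

ε-suc : ∀ {m i} → i ≢ m → ε m i ≡ ε (suc m) i
ε-suc {m} {i} i≢m with i <? m | i <? suc m | even? i
... | yes _   | yes _   | yes _ = refl
... | yes _   | yes _   | no  _ = refl
... | no  _   | no  _   | yes _ = refl
... | no  _   | no  _   | no  _ = refl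
... | yes i<m | no  i≮m | _     = contradiction (m≤n⇒m≤1+n i<m) i≮m
... | no  i≮m | yes i<m | _     = contradiction (≤∧≢⇒< (s≤s⁻¹ i<m) i≢m) i≮m

-- The factor 1 + q^m turns `one` into `over` when m is even and `nil` into `dist` when m is odd.
ε-split : ∀ m j → ε m m j ≡ ε (suc m) m j + shift 1 (ε (suc m) m) j
ε-split m j with m <? m | m <? suc m | even? m
... | yes m<m | _       | _ = contradiction m<m (n≮n m)
... | no _    | no m≮m  | _ = contradiction (n<1+n m) m≮m
ε-split m zero          | no _ | yes _ | yes _ = refl
ε-split m (suc j)       | no _ | yes _ | yes _ = refl
ε-split m zero          | no _ | yes _ | no  _ = refl
ε-split m (suc zero)    | no _ | yes _ | no  _ = refl
ε-split m (suc (suc j)) | no _ | yes _ | no  _ = refl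

E : ℕ → ℕ → ℕ
E m = Z∞ (ε m)

E-rec : ∀ {m} → 0 < m → ∀ n → E m n ≡ E (suc m) n + shift m (E (suc m)) n
E-rec {m} 0<m n = trans
  (Z∞-split (ε m) s s (ε-normalised m) (ε-normalised (suc m) m) (ε-normalised (suc m) m) 0<m (ε-split m) n)
  (cong₂ _+_ (Z∞-cong eq n) (shift-cong m (Z∞-cong eq) n))
  where
  s = ε (suc m) m
  eq : ∀ {i} → 0 < i → (ε m [ m ≔ s ]) i ≗ ε (suc m) i
  eq {i} _ j with i ≟ m
  ... | yes refl = refl
  ... | no i≢m   = cong (λ u → u j) (ε-suc i≢m)

-- The series (-q^{k+1};q)_∞ / ((q;q)_k (q^{2k+2};q²)_∞), whose independence
-- of k is Euler's theorem.
Y : ℕ → Weights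
Y k i with i ≤? k | even? i | 2 * suc k ≤? i
... | yes _ | _     | _     = one
... | no  _ | yes _ | yes _ = over
... | no  _ | _     | _     = dist

Y-normalised : ∀ k → Normalised (Y k)
Y-normalised k i with i ≤? k | even? i | 2 * suc k ≤? i
... | yes _ | _     | _     = refl
... | no  _ | yes _ | yes _ = refl
... | no  _ | yes _ | no _  = refl
... | no  _ | no _  | _     = refl

Y-other : ∀ {k i} → i ≢ suc k → i ≢ 2 * suc k → Y k i ≡ Y (suc k) i
Y-other {k} {i} i≢a i≢b with i ≤? k | i ≤? suc k | even? i | 2 * suc k ≤? i | 2 * suc (suc k) ≤? i
... | yes _   | yes _   | _     | _     | _     = refl
... | yes i≤k | no  i≰k | _     | _     | _     = contradiction (m≤n⇒m≤1+n i≤k) i≰k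
... | no  i≰k | yes i≤k | _     | _     | _     = contradiction (s≤s⁻¹ (≤∧≢⇒< i≤k i≢a)) i≰k
... | no  _   | no  _   | no  _ | _     | _     = refl
... | no  _   | no  _   | yes _ | yes _ | yes _ = refl
... | no  _   | no  _   | yes _ | no  _ | no _  = refl
... | no  _   | no  _   | yes _ | no b≰i | yes b≤i =
  contradiction (≤-trans (*-monoʳ-≤ 2 (n≤1+n (suc k))) b≤i) b≰i
-- An even number above 2k+2 is at least 2k+4, so this case is empty.
... | no  _   | no  _   | yes (divides q refl) | yes b≤i | no b≰i = contradiction
  (≤-trans (*-monoʳ-≤ 2 {suc (suc k)} {q} (*-cancelˡ-< 2 (suc k) q (≤∧≢⇒< (≤-trans b≤i (≤-reflexive (*-comm q 2))) λ eq →
    i≢b (trans (*-comm q 2) (sym eq))))) (≤-reflexive (*-comm 2 q))) b≰i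

1+k<2*[1+k] : ∀ k → suc k < 2 * suc k
1+k<2*[1+k] k = m<m+n (suc k) z<s

Y-over : ∀ k → Y k (2 * suc k) ≡ over
Y-over k with 2 * suc k ≤? k | even? (2 * suc k) | 2 * suc k ≤? 2 * suc k
... | yes le | _      | _     = contradiction (≤-trans (<⇒≤ (1+k<2*[1+k] k)) le) (n≮n k)
... | no _   | no odd | _     = contradiction (m∣m*n (suc k)) odd
... | no _   | yes _  | no b≰b = contradiction ≤-refl b≰b
... | no _   | yes _  | yes _ = refl

Y-dist : ∀ {k i} → k < i → i < 2 * suc k → Y k i ≡ dist
Y-dist {k} {i} k<i i<b with i ≤? k | even? i | 2 * suc k ≤? i
... | yes i≤k | _     | _       = contradiction i≤k (<⇒≱ k<i)
... | no _    | no _  | _       = refl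
... | no _    | yes _ | no _    = refl
... | no _    | yes _ | yes b≤i = contradiction b≤i (<⇒≱ i<b)

Y-one : ∀ {k i} → i ≤ k → Y k i ≡ one
Y-one {k} {i} i≤k with i ≤? k | even? i | 2 * suc k ≤? i
... | yes _  | _ | _ = refl
... | no i≰k | _ | _ = contradiction i≤k i≰k

shift-fixpoint-unique : ∀ {a f g} (h : ℕ → ℕ) → 0 < a → (∀ n → f n ≡ h n + shift a f n) →
                        (∀ n → g n ≡ h n + shift a g n) → f ≗ g
shift-fixpoint-unique {a} {f} {g} h 0<a fixf fixg = <-rec _ λ n rec → begin
  f n               ≡⟨ fixf n ⟩
  h n + shift a f n ≡⟨ cong (h n +_) (shift-cong≤ a λ {k} le → rec (≤-trans (m<m+n k 0<a) le)) ⟩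
  h n + shift a g n ≡⟨ fixg n ⟨
  g n               ∎
  where open ≡-Reasoning

-- With a = k+1 this is (1 + q^a)/(1 - q^{2a}) = 1/(1 - q^a), times the common remaining factors
-- `U`. In place of a division, both sides are shown to solve F = (1 + q^a) U + q^{2a} F.
Y-suc : ∀ k → Z∞ (Y k) ≗ Z∞ (Y (suc k))
Y-suc k = shift-fixpoint-unique {b} (λ n → Z∞ U n + shift a (Z∞ U) n) z<s left right
  where
  open ≡-Reasoning
  a b : ℕ
  a = suc k
  b = 2 * suc k
  U V : Weights
  U = Y (suc k) [ a ≔ nil ]
  V = Y k [ b ≔ dist ]

  split-one : ∀ j → one j ≡ nil j + shift 1 one j
  split-one zero    = refl
  split-one (suc j) = refl

  split-over : ∀ j → over j ≡ dist j + shift 1 over j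
  split-over zero          = refl
  split-over (suc zero)    = refl
  split-over (suc (suc j)) = refl

  split-dist : ∀ j → dist j ≡ nil j + shift 1 nil j
  split-dist zero          = refl
  split-dist (suc zero)    = refl
  split-dist (suc (suc j)) = refl

  ≔-id : ∀ w i s → w i ≡ s → ∀ j m → (w [ i ≔ s ]) j m ≡ w j m
  ≔-id w i s eq j m with j ≟ i
  ... | yes refl = cong (λ u → u m) (sym eq)
  ... | no _     = refl

  V-other : ∀ {j} → j ≢ a → V j ≡ Y (suc k) j
  V-other {j} j≢a with j ≟ b
  ... | yes refl = sym (Y-dist (1+k<2*[1+k] k) (*-monoʳ-< 2 (n<1+n (suc k))))
  ... | no j≢b   = Y-other j≢a j≢b

  V≗U : ∀ j m → (V [ a ≔ nil ]) j m ≡ U j m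
  V≗U j m with j ≟ a
  ... | yes _  = refl
  ... | no j≢a = cong (λ u → u m) (V-other j≢a)

  left : ∀ n → Z∞ (Y k) n ≡ (Z∞ U n + shift a (Z∞ U) n) + shift b (Z∞ (Y k)) n
  left n = begin
    Z∞ (Y k) n
      ≡⟨ Z∞-split (Y k) dist over (Y-normalised k) refl refl z<s
           (λ j → trans (cong (λ u → u j) (Y-over k)) (split-over j)) n ⟩
    Z∞ V n + shift b (Z∞ (Y k [ b ≔ over ])) n
      ≡⟨ cong (Z∞ V n +_) (shift-cong b (Z∞-cong λ {j} _ → ≔-id (Y k) b over (Y-over k) j) n) ⟩
    Z∞ V n + shift b (Z∞ (Y k)) n
      ≡⟨ cong (_+ shift b (Z∞ (Y k)) n)
           (Z∞-split V nil nil (≔-normalised (Y k) b dist (Y-normalised k) refl) refl refl z<s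
             (λ j → trans (cong (λ u → u j) (trans (≔-other (Y k) dist (<⇒≢ (1+k<2*[1+k] k)))
                            (Y-dist ≤-refl (1+k<2*[1+k] k)))) (split-dist j)) n) ⟩
    (Z∞ (V [ a ≔ nil ]) n + shift a (Z∞ (V [ a ≔ nil ])) n) + shift b (Z∞ (Y k)) n
      ≡⟨ cong (_+ shift b (Z∞ (Y k)) n)
           (cong₂ _+_ (Z∞-cong (λ {j} _ → V≗U j) n) (shift-cong a (Z∞-cong (λ {j} _ → V≗U j)) n)) ⟩
    (Z∞ U n + shift a (Z∞ U) n) + shift b (Z∞ (Y k)) n ∎

  right₁ : ∀ n → Z∞ (Y (suc k)) n ≡ Z∞ U n + shift a (Z∞ (Y (suc k))) n
  right₁ n = trans
    (Z∞-split (Y (suc k)) nil one (Y-normalised (suc k)) refl refl z<s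
      (λ j → trans (cong (λ u → u j) (Y-one {suc k} ≤-refl)) (split-one j)) n)
    (cong (Z∞ U n +_) (shift-cong a (Z∞-cong λ {j} _ → ≔-id (Y (suc k)) a one (Y-one {suc k} ≤-refl) j) n))

  right : ∀ n → Z∞ (Y (suc k)) n ≡ (Z∞ U n + shift a (Z∞ U) n) + shift b (Z∞ (Y (suc k))) n
  right n = begin
    Z∞ (Y (suc k)) n ≡⟨ right₁ n ⟩
    -- The recursion `right₁` has step q^a; inserting it into itself gives the step q^{2a} of the
    -- left side.
    Z∞ U n + shift a (Z∞ (Y (suc k))) n ≡⟨ cong (Z∞ U n +_) (shift-cong a right₁ n) ⟩
    Z∞ U n + shift a (λ m → Z∞ U m + shift a (Z∞ (Y (suc k))) m) n
      ≡⟨ cong (Z∞ U n +_) (shift-+ a (Z∞ U) _ n) ⟩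
    Z∞ U n + (shift a (Z∞ U) n + shift a (shift a (Z∞ (Y (suc k)))) n)
      ≡⟨ +-assoc (Z∞ U n) _ _ ⟨
    (Z∞ U n + shift a (Z∞ U) n) + shift a (shift a (Z∞ (Y (suc k)))) n
      ≡⟨ cong (Z∞ U n + shift a (Z∞ U) n +_) (trans (shift-shift a a _ n)
           (cong (λ c → shift c (Z∞ (Y (suc k))) n) (cong (a +_) (sym (+-identityʳ a))))) ⟩
    (Z∞ U n + shift a (Z∞ U) n) + shift b (Z∞ (Y (suc k))) n ∎

all-one : Weights
all-one _ = one

-- As `Y k` gives the same series for all k, coefficient n may be computed with k = n, where every
-- part up to n has weight `one`.
euler : E 1 ≗ Z∞ all-one
euler n = begin
  E 1 n        ≡⟨ Z∞-cong ε≗Y n ⟩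
  Z∞ (Y 0) n   ≡⟨ Y-const n ⟩
  Z∞ (Y n) n   ≡⟨ Z-cong n (λ _ i≤n m → cong (λ u → u m) (Y-one i≤n)) n ⟩
  Z∞ all-one n ∎
  where
  open ≡-Reasoning
  Y-const : ∀ k → Z∞ (Y 0) n ≡ Z∞ (Y k) n
  Y-const zero    = refl
  Y-const (suc k) = trans (Y-const k) (Y-suc k n)

  ε≗Y : ∀ {i} → 0 < i → ε 1 i ≗ Y 0 i
  ε≗Y {i} 0<i m with i <? 1 | i ≤? 0 | even? i | 2 ≤? i
  ... | yes i<1 | _       | _     | _     = contradiction i<1 (≤⇒≯ 0<i)
  ... | no _    | yes i≤0 | _     | _     = contradiction i≤0 (<⇒≱ 0<i)
  ... | no _    | no _    | no _  | _     = refl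
  ... | no _    | no _    | yes _ | yes _ = refl
  ... | no _    | no _    | yes e | no 2≰i = contradiction (∣⇒≤ {{>-nonZero 0<i}} e) 2≰i

-- The two iterations start at the same series: `diagonal 0` and `op 0 (H 0)` are both `G 0 1`.
rogers : ∀ {M n} → n < M →
         Σ< M (λ m → shift (Σ< m (λ i → 3 + 4 * i)) (E (2 * suc m)) n) ≡
         Σ< M (λ j → shift (Σ< j (λ i → 2 + 3 * i)) (Z∞ (all-one [ suc (2 * j) ≔ nil ])) n)
rogers {M} {n} n<M = ℤ.+-injective (trans
  (sym (iterate diagonal (λ m → E (2 * suc m)) (λ i → 3 + 4 * i) (λ _ → z<s) diagonal-step n<M))
  (iterate (λ k → op k (H k)) (λ j → Z∞ (R j)) (λ i → 2 + 3 * i) (λ _ → z<s) opH-step′ n<M))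
  where
  open FalseTheta (λ m n → pos (E m n)) (λ {m} 0<m n → trans (cong pos (E-rec 0<m n))
    (cong (ℤ._+_ (pos (E (suc m) n))) (sym (shift-map pos refl m (E (suc m)) n))))
  R : ℕ → Weights
  R j = all-one [ suc (2 * j) ≔ nil ]
  -- Thus (1 - q^{2j+1}) E_1 counts the partitions without the part 2j+1; its coefficients are
  -- natural, as `iterate` demands of the heads.
  remove : ∀ j n → E 1 n ≡ Z∞ (R j) n + shift (suc (2 * j)) (E 1) n
  remove j n = begin
    E 1 n ≡⟨ euler n ⟩
    Z∞ all-one n ≡⟨ Z∞-split all-one nil one (λ _ → refl) refl refl z<s (λ { zero → refl ; (suc _) → refl }) n ⟩
    Z∞ (R j) n + shift b (Z∞ (all-one [ b ≔ one ])) n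
      ≡⟨ cong (Z∞ (R j) n +_) (shift-cong b (λ m → trans (Z∞-cong (λ {i} _ → same i) m) (sym (euler m))) n) ⟩
    Z∞ (R j) n + shift b (E 1) n ∎
    where
    open ≡-Reasoning
    b = suc (2 * j)
    same : ∀ i → (all-one [ b ≔ one ]) i ≗ one
    same i m with i ≟ b
    ... | yes _ = refl
    ... | no _  = refl
  opH-step′ : ∀ k n → op k (H k) n ≡ pos (Z∞ (R k) n) ℤ.+ Shift.shift 0ℤ (2 + 3 * k) (op (suc k) (H (suc k))) n
  opH-step′ k n = trans (opH-step k n) (cong (λ x → x ℤ.+ Shift.shift 0ℤ (2 + 3 * k) (op (suc k) (H (suc k))) n) (begin
    pos (E 1 n) ℤ.- Shift.shift 0ℤ b (λ m → pos (E 1 m)) n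
      ≡⟨ cong₂ ℤ._-_ (cong pos (remove k n)) (shift-map pos refl b (E 1) n) ⟩
    (pos (Z∞ (R k) n) ℤ.+ pos (shift b (E 1) n)) ℤ.- pos (shift b (E 1) n)
      ≡⟨ cancel (pos (Z∞ (R k) n)) (pos (shift b (E 1) n)) ⟩
    pos (Z∞ (R k) n) ∎))
    where
    open ≡-Reasoning
    b = suc (2 * k)
    cancel : ∀ x y → (x ℤ.+ y) ℤ.- y ≡ x
    cancel = ℤ-Ring.solve-∀

-- Multiplicities of parts

multiplicity-here : ∀ k π → multiplicity k (k ∷ π) ≡ suc (multiplicity k π)
multiplicity-here k π = cong length (filter-accept (k ≟_) refl)

multiplicity-skip : ∀ {k x} π → k ≢ x → multiplicity k (x ∷ π) ≡ multiplicity k π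
multiplicity-skip π k≢x = cong length (filter-reject (_ ≟_) k≢x)

multiplicity-there : ∀ k x π → multiplicity k π ≤ multiplicity k (x ∷ π)
multiplicity-there k x π with k ≟ x
... | yes refl = ≤-trans (n≤1+n _) (≤-reflexive (sym (multiplicity-here k π)))
... | no k≢x   = ≤-reflexive (sym (multiplicity-skip π k≢x))

∈⇒0<multiplicity : ∀ {k π} → k ∈ π → 0 < multiplicity k π
∈⇒0<multiplicity {k} {π} (here refl) = subst (0 <_) (sym (multiplicity-here k _)) z<s
∈⇒0<multiplicity {k} {x ∷ π} (there k∈) = ≤-trans (∈⇒0<multiplicity k∈) (multiplicity-there k x π)

∉⇒multiplicity≡0 : ∀ {k π} → k ∉ π → multiplicity k π ≡ 0
∉⇒multiplicity≡0 {k} {[]}    k∉ = refl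
∉⇒multiplicity≡0 {k} {x ∷ π} k∉ =
  trans (multiplicity-skip π (k∉ ∘ here)) (∉⇒multiplicity≡0 (k∉ ∘ there))

0<multiplicity⇒∈ : ∀ {k π} → 0 < multiplicity k π → k ∈ π
0<multiplicity⇒∈ {k} {π} 0<m with k ∈? π
... | yes k∈ = k∈
... | no k∉  = contradiction (subst (0 <_) (∉⇒multiplicity≡0 k∉) 0<m) (n≮n 0)

multiplicity≡0⇒∉ : ∀ {k π} → multiplicity k π ≡ 0 → k ∉ π
multiplicity≡0⇒∉ eq k∈ = n≮n 0 (subst (0 <_) eq (∈⇒0<multiplicity k∈))

-- Weights see a partition only through its multiplicities, so distinctness of the odd parts has to
-- be expressed by them.
uniqueOdd⇒multiplicity≤1 : ∀ {k} π → Unique (filter odd? π) → Odd k → multiplicity k π ≤ 1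
uniqueOdd⇒multiplicity≤1 {k} [] _ _ = z≤n
uniqueOdd⇒multiplicity≤1 {k} (x ∷ π) uniq odd with k ≟ x
... | yes refl = ≤-trans (≤-reflexive (multiplicity-here k π)) (s≤s (≤-reflexive (∉⇒multiplicity≡0 k∉π)))
  where
  uniq′ : Unique (k ∷ filter odd? π)
  uniq′ = subst Unique (filter-accept odd? odd) uniq
  k∉π : k ∉ π
  k∉π k∈ with uniq′
  ... | k≢ ∷ _ = All.lookup k≢ (∈-filter⁺ odd? k∈ odd) refl
... | no k≢x = ≤-trans (≤-reflexive (multiplicity-skip π k≢x)) (uniqueOdd⇒multiplicity≤1 π (tail uniq) odd)
  where
  tail : Unique (filter odd? (x ∷ π)) → Unique (filter odd? π)
  tail u with odd? x
  ... | yes odd = AllPairs.tail (subst Unique (filter-accept odd? odd) u)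
  ... | no ¬odd = subst Unique (filter-reject odd? ¬odd) u

multiplicity≤1⇒uniqueOdd : ∀ π → (∀ {k} → Odd k → multiplicity k π ≤ 1) → Unique (filter odd? π)
multiplicity≤1⇒uniqueOdd []      _   = []
multiplicity≤1⇒uniqueOdd (x ∷ π) le with odd? x | multiplicity≤1⇒uniqueOdd π (λ {k} odd → ≤-trans (multiplicity-there k x π) (le odd))
... | no ¬odd | ih = subst Unique (sym (filter-reject odd? ¬odd)) ih
... | yes odd | ih = subst Unique (sym (filter-accept odd? odd)) (All.tabulate x≢ ∷ ih)
  where
  x≢ : ∀ {y} → y ∈ filter odd? π → x ≢ y
  x≢ y∈ refl = n≮n 0 (≤-trans (∈⇒0<multiplicity (proj₁ (∈-filter⁻ odd? {xs = π} y∈)))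
    (s≤s⁻¹ (≤-trans (≤-reflexive (sym (multiplicity-here x π))) (le odd))))

-- Enumeration of partitions by multiplicities

multiplicity-replicate-++ : ∀ m k π → multiplicity k (replicate m k ++ π) ≡ m + multiplicity k π
multiplicity-replicate-++ zero    k π = refl
multiplicity-replicate-++ (suc m) k π = trans (multiplicity-here k _) (cong suc (multiplicity-replicate-++ m k π))

multiplicity-replicate-skip : ∀ m {k x} π → k ≢ x → multiplicity k (replicate m x ++ π) ≡ multiplicity k π
multiplicity-replicate-skip zero    π k≢x = refl
multiplicity-replicate-skip (suc m) π k≢x =
  trans (multiplicity-skip _ k≢x) (multiplicity-replicate-skip m π k≢x)

sum-replicate-++ : ∀ m a π → sum (replicate m a ++ π) ≡ m * a + sum π
sum-replicate-++ zero    a π = refl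
sum-replicate-++ (suc m) a π = trans (cong (a +_) (sum-replicate-++ m a π)) (sym (+-assoc a _ _))

-- box B N lists the partitions with parts at most N, each occurring fewer
-- than B times.
box : ℕ → ℕ → List (List ℕ)
box B zero    = [] ∷ []
box B (suc N) = concatMap (λ m → map (replicate m (suc N) ++_) (box B N)) (upTo B)

∈-box-suc⁻ : ∀ {B N π} → π ∈ box B (suc N) →
             ∃₂ λ m ρ → m < B × ρ ∈ box B N × π ≡ replicate m (suc N) ++ ρ
∈-box-suc⁻ {B} {N} π∈ with find (∈-concatMap⁻ (λ m → map (replicate m (suc N) ++_) (box B N)) {xs = upTo B} π∈)
... | m , m∈ , π∈m with ∈-map⁻ (replicate m (suc N) ++_) π∈m
...   | ρ , ρ∈ , eq = m , ρ , ∈-upTo⁻ m∈ , ρ∈ , eq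

replicate-++-partition : ∀ m {a π} → 0 < a → IsPartition π → All (_≤ a) π →
                         IsPartition (replicate m a ++ π) × All (_≤ a) (replicate m a ++ π)
replicate-++-partition zero    0<a p le = p , le
replicate-++-partition (suc m) 0<a p le with replicate-++-partition m 0<a p le
... | mkIsPartition desc ps , le′ = mkIsPartition (link le′ desc) (0<a ∷ ps) , ≤-refl ∷ le′
  where
  link : ∀ {a π} → All (_≤ a) π → Linked _≥_ π → Linked _≥_ (a ∷ π)
  link []        _ = [-]
  link (x≤a ∷ _) l = x≤a ∷ l

box-sound : ∀ {B} N {π} → π ∈ box B N → IsPartition π × All (_≤ N) π
box-sound zero    (here refl) = mkIsPartition [] [] , []
box-sound {B} (suc N) π∈ with ∈-box-suc⁻ {B} {N} π∈
... | m , ρ , _ , ρ∈ , refl with box-sound N ρ∈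
...   | p , le = replicate-++-partition m z<s p (All.map m≤n⇒m≤1+n le)

peel : ∀ {N} π → IsPartition π → All (_≤ suc N) π →
       ∃₂ λ m ρ → π ≡ replicate m (suc N) ++ ρ × IsPartition ρ × All (_≤ N) ρ
peel [] p _ = 0 , [] , refl , p , []
peel {N} (x ∷ π) p@(mkIsPartition desc (_ ∷ ps)) (x≤ ∷ le) with m≤n⇒m<n∨m≡n x≤
... | inj₁ (s≤s x≤N) = 0 , x ∷ π , refl , p , x≤N ∷ All.map (λ y≤x → ≤-trans y≤x x≤N)
  (AllPairs.head (Linked.Linked⇒AllPairs (λ i≥j j≥k → ≤-trans j≥k i≥j) desc))
... | inj₂ refl with peel π (mkIsPartition (Linked.tail desc) ps) le
...   | m , ρ , refl , q , le′ = suc m , ρ , refl , q , le′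

-- No multiplicity exceeds the length, so a bound on the length bounds all of them at once.
box-complete : ∀ {B} N {π} → IsPartition π → All (_≤ N) π → length π < B → π ∈ box B N
box-complete zero {[]}    _ _ _ = here refl
box-complete zero {x ∷ _} (mkIsPartition _ (0<x ∷ _)) (x≤0 ∷ _) _ = contradiction x≤0 (<⇒≱ 0<x)
box-complete {B} (suc N) p le len< with peel _ p le
... | m , ρ , refl , q , le′ =
  ∈-concatMap⁺ (λ m → map (replicate m (suc N) ++_) (box B N)) (lose (∈-upTo⁺ m<B)
    (∈-map⁺ (replicate m (suc N) ++_) (box-complete N q le′ (≤-<-trans (m≤n+m _ m) len))))
  where
  len : m + length ρ < B
  len = subst (_< B) (trans (length-++ (replicate m (suc N))) (cong (_+ length ρ) (length-replicate m))) len<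
  m<B : m < B
  m<B = ≤-<-trans (m≤m+n m _) len

box-∉ : ∀ {B N ρ} → ρ ∈ box B N → suc N ∉ ρ
box-∉ {N = N} ρ∈ N∈ = n≮n N (All.lookup (proj₂ (box-sound N ρ∈)) N∈)

multiplicity-box : ∀ {B N ρ} m → ρ ∈ box B N → multiplicity (suc N) (replicate m (suc N) ++ ρ) ≡ m
multiplicity-box m ρ∈ = trans (multiplicity-replicate-++ m _ _)
  (trans (cong (m +_) (∉⇒multiplicity≡0 (box-∉ ρ∈))) (+-identityʳ m))

box-unique : ∀ B N → Unique (box B N)
box-unique B zero    = [] ∷ []
box-unique B (suc N) = Unique.concat⁺
  (All.map⁺ (All.universal (λ m → Unique.map⁺ (++-cancelˡ (replicate m (suc N)) _ _) (box-unique B N)) (upTo B)))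
  (AllPairs.map⁺ (AllPairs.map disjoint (Unique.upTo⁺ B)))
  where
  disjoint : ∀ {m m′} → m ≢ m′ → ∀ {π} →
             ¬ (π ∈ map (replicate m (suc N) ++_) (box B N) × π ∈ map (replicate m′ (suc N) ++_) (box B N))
  disjoint {m} {m′} m≢m′ (π∈ , π∈′) with ∈-map⁻ _ π∈ | ∈-map⁻ _ π∈′
  ... | ρ , ρ∈ , refl | ρ′ , ρ′∈ , eq = m≢m′ (trans (sym (multiplicity-box m ρ∈))
    (trans (cong (multiplicity (suc N)) eq) (multiplicity-box m′ ρ′∈)))

unique∧set⇒↭ : ∀ {A : Set} {xs ys : List A} → Unique xs → Unique ys →
               (∀ {x} → x ∈ xs → x ∈ ys) → (∀ {x} → x ∈ ys → x ∈ xs) → xs ↭ ys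
unique∧set⇒↭ xs! ys! to from = ∼bag⇒↭ (unique∧set⇒bag xs! ys! (mk⇔ to from))

length≤sum : ∀ {π} → All (0 <_) π → length π ≤ sum π
length≤sum []        = z≤n
length≤sum (0<x ∷ ps) = +-mono-≤ 0<x (length≤sum ps)

-- `partitions` is built from compositions, whereas `Z` recurses on the largest part size as `box`
-- does. A partition of n has at most n parts, hence multiplicities below n + 1.
partitions↭box : ∀ {N n} → n ≤ N → partitions n ↭ filter (λ π → sum π ≟ n) (box (suc n) N)
partitions↭box {N} {n} n≤N = unique∧set⇒↭ (partitions-unique n)
  (Unique.filter⁺ _ (box-unique (suc n) N)) to from
  where
  to : ∀ {π} → π ∈ partitions n → π ∈ filter (λ π → sum π ≟ n) (box (suc n) N)
  to {π} π∈ with partitions-sound n π∈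
  ... | p , refl = ∈-filter⁺ (λ π → sum π ≟ n)
    (box-complete N p (All.tabulate (λ k∈ → ≤-trans (∈⇒≤sum k∈) n≤N)) (s≤s (length≤sum (IsPartition.positive p)))) refl
  from : ∀ {π} → π ∈ filter (λ π → sum π ≟ n) (box (suc n) N) → π ∈ partitions n
  from π∈ with ∈-filter⁻ (λ π → sum π ≟ n) {xs = box (suc n) N} π∈
  ... | π∈box , eq = partitions-complete n (proj₁ (box-sound N π∈box)) eq

-- Weighted sums over partitions

module _ {A : Set} where

  sum-map-cong : ∀ (xs : List A) {f g : A → ℕ} → (∀ {x} → x ∈ xs → f x ≡ g x) → sum (map f xs) ≡ sum (map g xs)
  sum-map-cong []       eq = refl
  sum-map-cong (x ∷ xs) eq = cong₂ _+_ (eq (here refl)) (sum-map-cong xs (eq ∘ there))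

  sum-map-filter : ∀ {P : Pred A 0ℓ} (P? : Decidable P) (f : A → ℕ) xs →
                   sum (map f (filter P? xs)) ≡ sum (map (λ x → if does (P? x) then f x else 0) xs)
  sum-map-filter P? f []       = refl
  sum-map-filter P? f (x ∷ xs) with does (P? x)
  ... | true  = cong (f x +_) (sum-map-filter P? f xs)
  ... | false = sum-map-filter P? f xs

  sum-map-Σ< : ∀ M (f : ℕ → A → ℕ) xs →
               sum (map (λ x → Σ< M (λ m → f m x)) xs) ≡ Σ< M (λ m → sum (map (f m) xs))
  sum-map-Σ< M f []       = sym (Σ<-zero M (λ _ → refl))
  sum-map-Σ< M f (x ∷ xs) = trans (cong (Σ< M (λ m → f m x) +_) (sum-map-Σ< M f xs))
    (sym (Σ<-+ M (λ m → f m x) (λ m → sum (map (f m) xs))))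

  sum-map-* : ∀ c (f : A → ℕ) xs → sum (map (λ x → c * f x) xs) ≡ c * sum (map f xs)
  sum-map-* c f []       = sym (*-zeroʳ c)
  sum-map-* c f (x ∷ xs) = trans (cong (c * f x +_) (sum-map-* c f xs)) (sym (*-distribˡ-+ c (f x) _))

  shift-sum : ∀ a (f : A → ℕ → ℕ) xs →
              shift a (λ n → sum (map (λ x → f x n) xs)) ≗ λ n → sum (map (λ x → shift a (f x) n) xs)
  shift-sum a f []       n = shift-map {y = 0} (λ _ → 0) refl a (λ _ → 0) n
  shift-sum a f (x ∷ xs) n = trans (shift-+ a (f x) _ n) (cong (shift a (f x) n +_) (shift-sum a f xs n))

  sum-map-concatMap : ∀ {B : Set} (f : B → List A) (g : A → ℕ) xs →
                      sum (map g (concatMap f xs)) ≡ sum (map (λ x → sum (map g (f x))) xs)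
  sum-map-concatMap f g []       = refl
  sum-map-concatMap f g (x ∷ xs) = trans (cong sum (map-++ g (f x) _)) (trans (sum-++ (map g (f x)) _)
    (cong (sum (map g (f x)) +_) (sum-map-concatMap f g xs)))

  sum-map-map : ∀ {B : Set} (f : B → A) (g : A → ℕ) xs → sum (map g (map f xs)) ≡ sum (map (g ∘ f) xs)
  sum-map-map f g []       = refl
  sum-map-map f g (x ∷ xs) = cong (g (f x) +_) (sum-map-map f g xs)

sum-map-upTo : ∀ f n → sum (map f (upTo n)) ≡ Σ< n f
sum-map-upTo f n = trans (cong sum (map-applyUpTo (λ x → x) f n)) (go f n)
  where
  go : ∀ f n → sum (applyUpTo f n) ≡ Σ< n f
  go f zero    = refl
  go f (suc n) = cong (f 0 +_) (go (f ∘ suc) n)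

-- Absent parts contribute the factor `w i 0`, so a zero weight can demand the presence of a part as
-- well as its absence.
W : ℕ → Weights → List ℕ → ℕ
W zero    w π = 1
W (suc N) w π = w (suc N) (multiplicity (suc N) π) * W N w π

W-cong : ∀ N {w} {π ρ} → (∀ {i} → i ≤ N → multiplicity i π ≡ multiplicity i ρ) → W N w π ≡ W N w ρ
W-cong zero    eq = refl
W-cong (suc N) {w} eq = cong₂ _*_ (cong (w (suc N)) (eq ≤-refl)) (W-cong N (eq ∘ m≤n⇒m≤1+n))

W-replicate : ∀ {B N ρ} w m → ρ ∈ box B N → W (suc N) w (replicate m (suc N) ++ ρ) ≡ w (suc N) m * W N w ρ
W-replicate {N = N} {ρ} w m ρ∈ = cong₂ _*_ (cong (w (suc N)) (multiplicity-box m ρ∈))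
  (W-cong N λ i≤N → multiplicity-replicate-skip m ρ λ { refl → n≮n N i≤N })

constant : ℕ → ℕ → ℕ
constant v zero    = v
constant v (suc _) = 0

-- The series v q^s. It turns the test `sum π ≟ n` into taking a coefficient, and adjoining copies
-- of a part into a shift.
monomial : ℕ → ℕ → ℕ → ℕ
monomial v s = shift s (constant v)

monomial-≟ : ∀ v s n → (if does (s ≟ n) then v else 0) ≡ monomial v s n
monomial-≟ v zero    zero    = refl
monomial-≟ v zero    (suc n) = refl
monomial-≟ v (suc s) zero    = refl
monomial-≟ v (suc s) (suc n) = monomial-≟ v s n

monomial-* : ∀ c v a s n → monomial (c * v) (a + s) n ≡ c * shift a (monomial v s) n
monomial-* c v a s n = begin
  monomial (c * v) (a + s) n         ≡⟨ shift-cong (a + s) (λ { zero → refl ; (suc _) → sym (*-zeroʳ c) }) n ⟩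
  shift (a + s) (λ k → c * δ k) n    ≡⟨ shift-* (a + s) c δ n ⟩
  c * shift (a + s) δ n              ≡⟨ cong (c *_) (shift-shift a s δ n) ⟨
  c * shift a (monomial v s) n       ∎
  where
  open ≡-Reasoning
  δ = constant v

-- Expanding the product `Z` yields one monomial for each choice of multiplicities. B stays fixed
-- while shifts lower n, hence the hypothesis n < B.
sum-box : ∀ {B n} N w → n < B → sum (map (λ π → monomial (W N w π) (sum π) n) (box B N)) ≡ Z N w n
sum-box {n = zero}  zero w n<B = refl
sum-box {n = suc n} zero w n<B = refl
sum-box {B} {n} (suc N) w n<B = begin
  sum (map g (box B (suc N)))
    ≡⟨ sum-map-concatMap (λ m → map (replicate m (suc N) ++_) (box B N)) g (upTo B) ⟩
  sum (map (λ m → sum (map g (map (replicate m (suc N) ++_) (box B N)))) (upTo B))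
    ≡⟨ sum-map-upTo _ B ⟩
  Σ< B (λ m → sum (map g (map (replicate m (suc N) ++_) (box B N))))
    ≡⟨ Σ<-cong B (λ {m} _ → inner m) ⟩
  Σ< B (λ m → u m * shift (m * suc N) (Z N w) n)
    ≡⟨ mulUpTo≡mulAt N u (Z N w) n<B ⟩
  Z (suc N) w n ∎
  where
  open ≡-Reasoning
  u = w (suc N)
  g : List ℕ → ℕ
  g π = monomial (W (suc N) w π) (sum π) n
  h : List ℕ → ℕ → ℕ
  h ρ = monomial (W N w ρ) (sum ρ)
  inner : ∀ m → sum (map g (map (replicate m (suc N) ++_) (box B N))) ≡ u m * shift (m * suc N) (Z N w) n
  inner m = begin
    sum (map g (map (replicate m (suc N) ++_) (box B N)))
      ≡⟨ sum-map-map (replicate m (suc N) ++_) g (box B N) ⟩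
    sum (map (λ ρ → g (replicate m (suc N) ++ ρ)) (box B N))
      ≡⟨ sum-map-cong (box B N) (λ {ρ} ρ∈ → trans
           (cong₂ (λ v s → monomial v s n) (W-replicate w m ρ∈) (sum-replicate-++ m (suc N) ρ))
           (monomial-* (u m) (W N w ρ) (m * suc N) (sum ρ) n)) ⟩
    sum (map (λ ρ → u m * shift (m * suc N) (h ρ) n) (box B N))
      ≡⟨ sum-map-* (u m) (λ ρ → shift (m * suc N) (h ρ) n) (box B N) ⟩
    u m * sum (map (λ ρ → shift (m * suc N) (h ρ) n) (box B N))
      ≡⟨ cong (u m *_) (shift-sum (m * suc N) h (box B N) n) ⟨
    u m * shift (m * suc N) (λ k → sum (map (λ ρ → h ρ k) (box B N))) n
      ≡⟨ cong (u m *_) (shift-cong≤ (m * suc N) λ {k} le → sum-box N w (≤-<-trans (m+n≤o⇒m≤o k le) n<B)) ⟩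
    u m * shift (m * suc N) (Z N w) n ∎

sum-partitions : ∀ {N n} w → n ≤ N → sum (map (W N w) (partitions n)) ≡ Z N w n
sum-partitions {N} {n} w n≤N = begin
  sum (map (W N w) (partitions n))
    ≡⟨ sum-↭ (map⁺ (W N w) (partitions↭box n≤N)) ⟩
  sum (map (W N w) (filter (λ π → sum π ≟ n) (box (suc n) N)))
    ≡⟨ sum-map-filter (λ π → sum π ≟ n) (W N w) (box (suc n) N) ⟩
  sum (map (λ π → if does (sum π ≟ n) then W N w π else 0) (box (suc n) N))
    ≡⟨ sum-map-cong (box (suc n) N) (λ {π} _ → monomial-≟ (W N w π) (sum π) n) ⟩
  sum (map (λ π → monomial (W N w π) (sum π) n) (box (suc n) N))
    ≡⟨ sum-box N w (n<1+n n) ⟩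
  Z N w n ∎
  where open ≡-Reasoning

-- Sorting partitions by their least missing odd number

Σ<-single : ∀ M {j} f → j < M → (∀ {m} → m < M → f m ≢ 0 → m ≡ j) → Σ< M f ≡ f j
Σ<-single (suc M) {zero} f _ only = trans
  (cong (f 0 +_) (Σ<-zero M λ {m} m<M → decidable-stable (f (suc m) ≟ 0) λ ≢0 → contradiction (only (s≤s m<M) ≢0) λ ()))
  (+-identityʳ (f 0))
Σ<-single (suc M) {suc j} f (s≤s j<M) only = cong₂ _+_
  (decidable-stable (f 0 ≟ 0) λ ≢0 → contradiction (only z<s ≢0) λ ())
  (Σ<-single M (f ∘ suc) j<M λ m<M ≢0 → suc-injective (only (s≤s m<M) ≢0))

Σ<-dec : ∀ {X : Set} (X? : Dec X) M {j v} f → j < M →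
         (∀ {m} → m < M → f m ≢ 0 → m ≡ j × X) → (X → f j ≡ v) →
         (if does X? then v else 0) ≡ Σ< M f
Σ<-dec (yes x) M f j<M only value = sym (trans (Σ<-single M f j<M (λ m<M ≢0 → proj₁ (only m<M ≢0))) (value x))
Σ<-dec (no ¬x) M f j<M only value = sym (Σ<-zero M λ {m} m<M →
  decidable-stable (f m ≟ 0) λ ≢0 → ¬x (proj₂ (only m<M ≢0)))

least-≤ : ∀ {P : Pred ℕ 0ℓ} (P? : Decidable P) n → least P? n ≤ n
least-≤ P? zero    = z≤n
least-≤ P? (suc n) with P? 0
... | yes _ = z≤n
... | no _  = s≤s (least-≤ (P? ∘ suc) n)

-- The weights `w m` vanish on π unless π lies in S and has index m, so summing them over m tests
-- membership and attaches `v π`; exchanging the sums sorts S by index. No index exceeds the size n.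
generatingSeries≡ΣZ : ∀ {S : Pred (List ℕ) 0ℓ} (S? : Decidable S) v (w : ℕ → Weights) {N n} → n ≤ N →
  (∀ {π m} → π ∈ partitions n → m ≤ n → W N (w m) π ≢ 0 → m ≡ oddMexIndex π × S π) →
  (∀ {π} → π ∈ partitions n → S π → W N (w (oddMexIndex π)) π ≡ v π) →
  generatingSeries S? v n ≡ Σ< (suc n) (λ m → Z N (w m) n)
generatingSeries≡ΣZ S? v w {N} {n} n≤N only value = begin
  sum (map v (filter S? (partitions n)))
    ≡⟨ sum-map-filter S? v (partitions n) ⟩
  sum (map (λ π → if does (S? π) then v π else 0) (partitions n))
    ≡⟨ sum-map-cong (partitions n) (λ {π} π∈ → Σ<-dec (S? π) (suc n) (λ m → W N (w m) π) (s≤s (index≤ π∈))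
         (λ m<M → only π∈ (s≤s⁻¹ m<M)) (value π∈)) ⟩
  sum (map (λ π → Σ< (suc n) (λ m → W N (w m) π)) (partitions n))
    ≡⟨ sum-map-Σ< (suc n) (λ m → W N (w m)) (partitions n) ⟩
  Σ< (suc n) (λ m → sum (map (W N (w m)) (partitions n)))
    ≡⟨ Σ<-cong (suc n) (λ {m} _ → sum-partitions (w m) n≤N) ⟩
  Σ< (suc n) (λ m → Z N (w m) n) ∎
  where
  open ≡-Reasoning
  index≤ : ∀ {π} → π ∈ partitions n → oddMexIndex π ≤ n
  index≤ {π} π∈ = ≤-trans (least-≤ _ (sum π)) (≤-reflexive (proj₂ (partitions-sound n π∈)))

W-factor≢0 : ∀ N {w π} → W N w π ≢ 0 → ∀ {i} → 0 < i → i ≤ N → w i (multiplicity i π) ≢ 0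
W-factor≢0 zero    _  0<i i≤0 _ = contradiction i≤0 (<⇒≱ 0<i)
W-factor≢0 (suc N) {w} {π} ≢0 {i} 0<i i≤N eq with m≤n⇒m<n∨m≡n i≤N
... | inj₁ (s≤s i≤N′) = W-factor≢0 N {w} {π} (λ W≡0 → ≢0 (trans (cong (w (suc N) _ *_) W≡0) (*-zeroʳ (w (suc N) _)))) 0<i i≤N′ eq
... | inj₂ refl       = ≢0 (cong (_* W N w π) eq)

2∤1+2*m : ∀ m → Odd (suc (2 * m))
2∤1+2*m m 2∣ with ∣1⇒≡1 (∣m+n∣m⇒∣n (subst (2 ∣_) (+-comm 1 (2 * m)) 2∣) (m∣m*n m))
... | ()

even-or-odd : ∀ n → (∃ λ a → n ≡ 2 * a) ⊎ (∃ λ a → n ≡ suc (2 * a))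
even-or-odd zero = inj₁ (0 , refl)
even-or-odd (suc n) with even-or-odd n
... | inj₁ (a , refl) = inj₂ (a , refl)
... | inj₂ (a , refl) = inj₁ (suc a , sym (*-suc 2 a))

odd⇒1+2*m : ∀ {n} → Odd n → ∃ λ a → n ≡ suc (2 * a)
odd⇒1+2*m {n} odd with even-or-odd n
... | inj₁ (a , refl) = contradiction (m∣m*n a) odd
... | inj₂ r          = r

module _ {π : List ℕ} where

  oddMexIndex-unique : ∀ {m} → suc (2 * m) ∉ π → (∀ {j} → j < m → suc (2 * j) ∈ π) → m ≡ oddMexIndex π
  oddMexIndex-unique {m} ∉π ∈π with <-cmp m (oddMexIndex π)
  ... | tri< m< _ _ = contradiction (proj₂ (oddMex-spec π) m<) ∉π
  ... | tri≈ _ eq _ = eq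
  ... | tri> _ _ >m = contradiction (∈π >m) (proj₁ (oddMex-spec π))

  mex-unique : ∀ {k} → 0 < k → k ∉ π → (∀ {i} → 0 < i → i < k → i ∈ π) → k ≡ mex π
  mex-unique {k} 0<k ∉π ∈π with <-cmp k (mex π)
  ... | tri< k< _ _ = contradiction (proj₂ (mex-spec π) 0<k k<) ∉π
  ... | tri≈ _ eq _ = eq
  ... | tri> _ _ >k = contradiction (∈π z<s >k) (proj₁ (mex-spec π))

-- Weights for `P-dom`

indicator : ∀ {X : Set} → Dec X → ℕ
indicator (yes _) = 1
indicator (no _)  = 0

-- The partitions in P_dom with mex 2m+1.
dom-delay : ℕ → ℕ → ℕ
dom-delay m i = indicator (i ≤? 2 * m)

-- After the compulsory copy, `nil` keeps an odd i < 2m at multiplicity 1, and with no delay it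
-- excludes 2m+1. Beyond, `dist` keeps odd parts distinct and `over` gives 2 for each even part that
-- occurs, which multiplies up to 2^τ.
dom : ℕ → Weights
dom m i = shift (dom-delay m i) (ε (2 * suc m) i)

two : ∀ {X : Set} → Dec X → ℕ
two (yes _) = 2
two (no _)  = 1

DomCondition : ℕ → ℕ → ℕ → Set
DomCondition m i u = (i ≤ 2 * m → 0 < u) × (i ≡ suc (2 * m) → u ≡ 0) × (Odd i → u ≤ 1)

dom≢0 : ∀ m i u → dom m i u ≢ 0 → DomCondition m i u
dom≢0 m i u ≢0 with i ≤? 2 * m | i <? 2 * suc m | even? i
dom≢0 m i zero          ≢0 | yes _ | _      | _     = contradiction refl ≢0
dom≢0 m i (suc u)       ≢0 | yes i≤ | no i≮ | _     =
  contradiction (≤-<-trans i≤ (*-monoʳ-< 2 (n<1+n m))) i≮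
dom≢0 m i (suc u)       ≢0 | yes i≤ | yes _ | yes e =
  (λ _ → z<s) , (λ { refl → contradiction i≤ (n≮n _) }) , λ odd → contradiction e odd
dom≢0 m i (suc zero)    ≢0 | yes i≤ | yes _ | no _  =
  (λ _ → z<s) , (λ { refl → contradiction i≤ (n≮n _) }) , λ _ → ≤-refl
dom≢0 m i (suc (suc u)) ≢0 | yes i≤ | yes _ | no _  = contradiction refl ≢0
dom≢0 m i u             ≢0 | no i≰ | yes i< | yes e =
  (λ i≤ → contradiction i≤ i≰) , (λ { refl → contradiction e (2∤1+2*m m) }) , λ odd → contradiction e odd
dom≢0 m i zero          ≢0 | no i≰ | yes i< | no _  =
  (λ i≤ → contradiction i≤ i≰) , (λ _ → refl) , λ _ → z≤n
dom≢0 m i (suc u)       ≢0 | no i≰ | yes i< | no _  = contradiction refl ≢0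
dom≢0 m i u             ≢0 | no i≰ | no i≮ | yes e  =
  (λ i≤ → contradiction i≤ i≰) , (λ { refl → contradiction e (2∤1+2*m m) }) , λ odd → contradiction e odd
dom≢0 m i u             ≢0 | no i≰ | no i≮ | no _   =
  (λ i≤ → contradiction i≤ i≰) , (λ { refl → contradiction (≤-reflexive (sym (*-suc 2 m))) i≮ }) , λ _ → dist≢0 u ≢0
  where
  dist≢0 : ∀ u → dist u ≢ 0 → u ≤ 1
  dist≢0 zero          _ = z≤n
  dist≢0 (suc zero)    _ = ≤-refl
  dist≢0 (suc (suc u)) ≢0 = contradiction refl ≢0

-- Meant for X the membership of i in the list whose distinct elements τ counts.
dom-value : ∀ {X : Set} (X? : Dec X) m i u → DomCondition m i u →
            (X → Even i × suc (2 * m) < i × 0 < u) → (Even i × suc (2 * m) < i × 0 < u → X) →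
            dom m i u ≡ two X?
dom-value X? m i u (present , absent , distinct) to from with i ≤? 2 * m | i <? 2 * suc m | even? i
dom-value X? m i zero (present , absent , distinct) to from | yes i≤ | _ | _ = contradiction (present i≤) (n≮n 0)
dom-value X? m i (suc u) _ to from | yes i≤ | no i≮ | _ =
  contradiction (≤-<-trans i≤ (*-monoʳ-< 2 (n<1+n m))) i≮
dom-value (yes x) m i (suc u) _ to from | yes i≤ | yes _ | _ =
  contradiction (≤-trans (proj₁ (proj₂ (to x))) i≤) (<⇒≯ (n<1+n _))
dom-value (no _) m i (suc u) _ to from | yes i≤ | yes _ | yes e = refl
dom-value (no _) m i (suc u) (_ , _ , distinct) to from | yes i≤ | yes _ | no odd with distinct odd
... | s≤s z≤n = refl
-- The bounds 2m < i < 2m+2 leave only 2m+1, which is not even.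
dom-value X? m i u (_ , absent , _) to from | no i≰ | yes i< | yes e = contradiction
  (subst Even (≤-antisym (s≤s⁻¹ (≤-trans i< (≤-reflexive (*-suc 2 m)))) (≰⇒> i≰)) e) (2∤1+2*m m)
dom-value (yes x) m i u (_ , absent , _) to from | no i≰ | yes i< | no odd = contradiction (proj₁ (to x)) odd
dom-value (no _) m i u (_ , absent , _) to from | no i≰ | yes i< | no odd
  with absent (≤-antisym (s≤s⁻¹ (≤-trans i< (≤-reflexive (*-suc 2 m)))) (≰⇒> i≰))
... | refl = refl
dom-value (yes x) m i u _ to from | no i≰ | no i≮ | no odd = contradiction (proj₁ (to x)) odd
dom-value (no _) m i u (_ , _ , distinct) to from | no i≰ | no i≮ | no odd with distinct odd
... | z≤n     = refl
... | s≤s z≤n = refl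
dom-value (yes x) m i zero _ to from | no i≰ | no i≮ | yes e = contradiction (proj₂ (proj₂ (to x))) (n≮n 0)
dom-value (yes x) m i (suc u) _ to from | no i≰ | no i≮ | yes e = refl
dom-value (no _) m i zero _ to from | no i≰ | no i≮ | yes e = refl
dom-value (no ¬x) m i (suc u) _ to from | no i≰ | no i≮ | yes e =
  contradiction (from (e , ≤-trans (≤-reflexive (sym (*-suc 2 m))) (≮⇒≥ i≮) , z<s)) ¬x

range : ℕ → List ℕ
range N = map suc (downFrom N)

∈-range⁺ : ∀ {N k} → 0 < k → k ≤ N → k ∈ range N
∈-range⁺ {k = suc k} _ k≤N = ∈-map⁺ suc (∈-downFrom⁺ k≤N)

W-two : ∀ N {w π} (xs : List ℕ) → (∀ {i} → 0 < i → i ≤ N → w i (multiplicity i π) ≡ two (i ∈? xs)) →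
        W N w π ≡ 2 ^ length (filter (_∈? xs) (range N))
W-two zero    xs eq = refl
W-two (suc N) {w} {π} xs eq = trans
  (cong₂ _*_ (eq z<s ≤-refl) (W-two N {w} {π} xs (λ 0<i i≤N → eq 0<i (m≤n⇒m≤1+n i≤N))))
  (step (suc N ∈? xs))
  where
  step : (d : Dec (suc N ∈ xs)) → two d * 2 ^ length (filter (_∈? xs) (range N)) ≡
         2 ^ length (filter (_∈? xs) (suc N ∷ range N))
  step (yes N∈) = cong (λ ys → 2 ^ length ys) (sym (filter-accept (_∈? xs) N∈))
  step (no N∉)  = trans (*-identityˡ _) (cong (λ ys → 2 ^ length ys) (sym (filter-reject (_∈? xs) N∉)))

-- Both lists enumerate the same set without repetition; the bounds ensure that `range N` misses no
-- element of xs.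
length-deduplicate : ∀ {N} xs → (∀ {k} → k ∈ xs → 0 < k × k ≤ N) →
                     length (filter (_∈? xs) (range N)) ≡ length (deduplicate _≟_ xs)
length-deduplicate {N} xs bounds = ↭-length $ unique∧set⇒↭
  (Unique.filter⁺ (_∈? xs) (Unique.map⁺ suc-injective (Unique.downFrom⁺ N)))
  (DecUnique.deduplicate-! _≟_ xs)
  (λ k∈ → ∈-deduplicate⁺ _≟_ (proj₂ (∈-filter⁻ (_∈? xs) {xs = range N} k∈)))
  (λ k∈ → let k∈xs = ∈-deduplicate⁻ _≟_ xs k∈ ; 0<k , k≤N = bounds k∈xs in
    ∈-filter⁺ (_∈? xs) (∈-range⁺ 0<k k≤N) k∈xs)

∈-partition⁻ : ∀ {n π k} → π ∈ partitions n → k ∈ π → 0 < k × k ≤ n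
∈-partition⁻ {n} π∈ k∈ with partitions-sound n π∈
... | p , refl = All.lookup (IsPartition.positive p) k∈ , ∈⇒≤sum k∈

dom-only : ∀ {n π m} → π ∈ partitions n → m ≤ n → W (suc (2 * n)) (dom m) π ≢ 0 →
           m ≡ oddMexIndex π × P-dom π
dom-only {n} {π} {m} π∈ m≤n ≢0 = m≡ , mkP-dom (proj₁ (partitions-sound n π∈))
  (multiplicity≤1⇒uniqueOdd π odd≤1) (subst Odd mex≡ (2∤1+2*m m))
  where
  -- Parts of π are at most n, but the absence of 2m+1 must be read off for every m ≤ n.
  N = suc (2 * n)
  condition : ∀ {i} → 0 < i → i ≤ N → DomCondition m i (multiplicity i π)
  condition {i} 0<i i≤N = dom≢0 m i (multiplicity i π) (W-factor≢0 N {dom m} {π} ≢0 0<i i≤N)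
  ∈π : ∀ {i} → 0 < i → i < suc (2 * m) → i ∈ π
  ∈π 0<i (s≤s i≤) = 0<multiplicity⇒∈
    (proj₁ (condition 0<i (≤-trans i≤ (≤-trans (*-monoʳ-≤ 2 m≤n) (n≤1+n _)))) i≤)
  ∉π : suc (2 * m) ∉ π
  ∉π = multiplicity≡0⇒∉ (proj₁ (proj₂ (condition z<s (s≤s (*-monoʳ-≤ 2 m≤n)))) refl)
  m≡ : m ≡ oddMexIndex π
  m≡ = oddMexIndex-unique ∉π λ j<m → ∈π z<s (s≤s (*-monoʳ-< 2 j<m))
  mex≡ : suc (2 * m) ≡ mex π
  mex≡ = mex-unique z<s ∉π ∈π
  odd≤1 : ∀ {k} → Odd k → multiplicity k π ≤ 1
  odd≤1 {k} odd with k ∈? π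
  ... | no k∉  = subst (_≤ 1) (sym (∉⇒multiplicity≡0 k∉)) z≤n
  ... | yes k∈ with ∈-partition⁻ {n} π∈ k∈
  ...   | 0<k , k≤n = proj₂ (proj₂ (condition 0<k (≤-trans k≤n (≤-trans (m≤m+n n _) (n≤1+n _))))) odd

dom-τ : ∀ {n π} → π ∈ partitions n → P-dom π → W (suc (2 * n)) (dom (oddMexIndex π)) π ≡ 2 ^ τ π
dom-τ {n} {π} π∈ (mkP-dom p unique odd) = trans
  (W-two (suc (2 * n)) {dom j} {π} F (λ {i} 0<i _ → dom-value (i ∈? F) j i (multiplicity i π) (condition 0<i) to from))
  (cong (2 ^_) (length-deduplicate F λ k∈ → let 0<k , k≤n = ∈-partition⁻ {n} π∈ (proj₁ (∈-filter⁻ Q? {xs = π} k∈))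
    in 0<k , ≤-trans k≤n (≤-trans (m≤m+n n _) (n≤1+n _))))
  where
  j = oddMexIndex π
  Q? : Decidable (λ k → Even k × oddMex π < k)
  Q? k = even? k ×-dec (oddMex π <? k)
  F = filter Q? π
  -- An odd mex is also the least missing odd number, since everything below it is a part.
  mex≡ : mex π ≡ suc (2 * j)
  mex≡ with odd⇒1+2*m odd
  ... | a , eq = trans eq (cong (λ b → suc (2 * b)) (oddMexIndex-unique {m = a}
    (subst (_∉ π) eq (proj₁ (mex-spec π)))
    (λ {i} i<a → proj₂ (mex-spec π) z<s (subst (suc (2 * i) <_) (sym eq) (s≤s (*-monoʳ-< 2 i<a))))))
  condition : ∀ {i} → 0 < i → DomCondition j i (multiplicity i π)
  condition {i} 0<i =
    (λ i≤ → ∈⇒0<multiplicity (proj₂ (mex-spec π) 0<i (subst (i <_) (sym mex≡) (s≤s i≤)))) ,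
    (λ { refl → ∉⇒multiplicity≡0 (proj₁ (oddMex-spec π)) }) ,
    uniqueOdd⇒multiplicity≤1 π unique
  to : ∀ {i} → i ∈ F → Even i × suc (2 * j) < i × 0 < multiplicity i π
  to i∈ with ∈-filter⁻ Q? {xs = π} i∈
  ... | i∈π , even , j<i = even , j<i , ∈⇒0<multiplicity i∈π
  from : ∀ {i} → Even i × suc (2 * j) < i × 0 < multiplicity i π → i ∈ F
  from (even , j<i , 0<u) = ∈-filter⁺ Q? (0<multiplicity⇒∈ {π = π} 0<u) (even , j<i)

-- Weights for `U-ic`

-- The partitions in U_ic with smallest missing odd part 2j+1.
ic-delay : ℕ → ℕ → ℕ
ic-delay j i = indicator (i ≤? j) + indicator (odd? i ×-dec (i ≤? 2 * j))

-- One copy of each i ≤ j comes from the initial condition and one of each odd i < 2j from the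
-- minimality of 2j+1; an odd i ≤ j receives both, which is the required multiplicity 2.
ic : ℕ → Weights
ic j i = shift (ic-delay j i) ((all-one [ suc (2 * j) ≔ nil ]) i)

shift≢0 : ∀ {a u} f → shift a f u ≢ 0 → a ≤ u
shift≢0 {a} {u} f ≢0 with a ≤? u
... | yes a≤u = a≤u
... | no a≰u  = contradiction (shift-> f (≰⇒> a≰u)) ≢0

shift-one : ∀ {a u} → a ≤ u → shift a one u ≡ 1
shift-one z≤n       = refl
shift-one (s≤s a≤u) = shift-one a≤u

indicator-yes : ∀ {X : Set} (X? : Dec X) → X → indicator X? ≡ 1
indicator-yes (yes _) _ = refl
indicator-yes (no ¬x) x = contradiction x ¬x

indicator-no : ∀ {X : Set} (X? : Dec X) → ¬ X → indicator X? ≡ 0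
indicator-no (yes x) ¬x = contradiction x ¬x
indicator-no (no _)  _  = refl

indicator-cong : ∀ {X Y : Set} (X? : Dec X) (Y? : Dec Y) → (X → Y) → (Y → X) → indicator X? ≡ indicator Y?
indicator-cong (yes x) Y? to from = sym (indicator-yes Y? (to x))
indicator-cong (no ¬x) Y? to from = sym (indicator-no Y? (¬x ∘ from))

ic-delay-0 : ∀ j → ic-delay j (suc (2 * j)) ≡ 0
ic-delay-0 j = cong₂ _+_ (indicator-no (_ ≤? j) λ le → n≮n j (≤-trans (s≤s (m≤m+n j _)) le))
  (indicator-no (odd? (suc (2 * j)) ×-dec (suc (2 * j) ≤? 2 * j)) λ (_ , le) → n≮n _ le)

ic-only : ∀ {n π m} → π ∈ partitions n → m ≤ n → W (suc (2 * n)) (ic m) π ≢ 0 →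
           m ≡ oddMexIndex π × U-ic π
ic-only {n} {π} {m} π∈ m≤n ≢0 = m≡ , mkU-ic (proj₁ (partitions-sound n π∈)) initial
  where
  N = suc (2 * n)
  factor : ∀ {i} → 0 < i → i ≤ N → ic m i (multiplicity i π) ≢ 0
  factor = W-factor≢0 N {ic m} {π} ≢0
  delay≤ : ∀ {i} → 0 < i → i ≤ 2 * m → ic-delay m i ≤ multiplicity i π
  delay≤ {i} 0<i i≤ = shift≢0 {ic-delay m i} _ (factor 0<i (≤-trans i≤ (≤-trans (*-monoʳ-≤ 2 m≤n) (n≤1+n _))))
  ∉π : suc (2 * m) ∉ π
  ∉π = multiplicity≡0⇒∉ (nil≢0 _ (subst (λ f → f (multiplicity b π) ≢ 0) factor≡ (factor z<s (s≤s (*-monoʳ-≤ 2 m≤n)))))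
    where
    b = suc (2 * m)
    factor≡ : ic m b ≡ nil
    factor≡ = cong₂ shift (ic-delay-0 m) (≔-same all-one b nil)
    nil≢0 : ∀ u → nil u ≢ 0 → u ≡ 0
    nil≢0 zero    _  = refl
    nil≢0 (suc u) ≢0 = contradiction refl ≢0
  ∈π : ∀ {j} → j < m → suc (2 * j) ∈ π
  ∈π {j} j<m = 0<multiplicity⇒∈ (≤-trans
    (≤-trans (≤-reflexive (sym (indicator-yes (odd? i ×-dec (i ≤? 2 * m)) (2∤1+2*m j , i≤)))) (m≤n+m _ (indicator (i ≤? m))))
    (delay≤ z<s i≤))
    where
    i = suc (2 * j)
    i≤ : i ≤ 2 * m
    i≤ = *-monoʳ-< 2 j<m
  m≡ : m ≡ oddMexIndex π
  m≡ = oddMexIndex-unique ∉π ∈π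
  initial : ∀ {i} → i ≤ oddMexIndex π → 0 < i → (Even i → i ∈ π) × (Odd i → 2 ≤ multiplicity i π)
  initial {i} i≤j 0<i =
    (λ _ → 0<multiplicity⇒∈ (≤-trans (≤-trans (≤-reflexive (sym (indicator-yes (i ≤? m) i≤m))) (m≤m+n _ _)) (delay≤ 0<i i≤2m))) ,
    (λ odd → ≤-trans (≤-reflexive (sym (cong₂ _+_ (indicator-yes (i ≤? m) i≤m)
      (indicator-yes (odd? i ×-dec (i ≤? 2 * m)) (odd , i≤2m))))) (delay≤ 0<i i≤2m))
    where
    i≤m : i ≤ m
    i≤m = subst (i ≤_) (sym m≡) i≤j
    i≤2m : i ≤ 2 * m
    i≤2m = ≤-trans i≤m (m≤m+n m _)

ic-one : ∀ {n π} → π ∈ partitions n → U-ic π → W (suc (2 * n)) (ic (oddMexIndex π)) π ≡ 1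
ic-one {n} {π} π∈ (mkU-ic p initial) = W-one (suc (2 * n)) λ 0<i _ → factor 0<i
  where
  j = oddMexIndex π
  W-one : ∀ N → (∀ {i} → 0 < i → i ≤ N → ic j i (multiplicity i π) ≡ 1) → W N (ic j) π ≡ 1
  W-one zero    eq = refl
  W-one (suc N) eq = cong₂ _*_ (eq z<s ≤-refl) (W-one N λ 0<i i≤N → eq 0<i (m≤n⇒m≤1+n i≤N))
  delay≤ : ∀ {i} → 0 < i → ic-delay j i ≤ multiplicity i π
  delay≤ {i} 0<i = bound (i ≤? j) (odd? i ×-dec (i ≤? 2 * j))
    where
    bound : (d : Dec (i ≤ j)) (e : Dec (Odd i × i ≤ 2 * j)) → indicator d + indicator e ≤ multiplicity i π
    bound (yes i≤j) (yes (odd , _)) = proj₂ (initial i≤j 0<i) odd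
    bound (yes i≤j) (no _) with even? i
    ... | yes even = ∈⇒0<multiplicity (proj₁ (initial i≤j 0<i) even)
    -- An odd i ≤ j is at most 2j, so this case does not arise; the bound 2 ≤ multiplicity closes it
    -- directly.
    ... | no odd   = ≤-trans (n≤1+n 1) (proj₂ (initial i≤j 0<i) odd)
    bound (no _) (yes (odd , i≤2j)) with odd⇒1+2*m odd
    ... | a , refl = ∈⇒0<multiplicity (proj₂ (oddMex-spec π) (*-cancelˡ-< 2 a j i≤2j))
    bound (no _) (no _) = z≤n
  factor : ∀ {i} → 0 < i → ic j i (multiplicity i π) ≡ 1
  factor {i} 0<i with i ≟ suc (2 * j)
  ... | no _     = shift-one (delay≤ 0<i)
  ... | yes refl = cong₂ (λ a u → shift a nil u) (ic-delay-0 j) (∉⇒multiplicity≡0 (proj₁ (oddMex-spec π)))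

-- Sizes of the compulsory parts

exponent-cong : ∀ N {μ ν} → (∀ {i} → 0 < i → i ≤ N → μ i ≡ ν i) → exponent N μ ≡ exponent N ν
exponent-cong zero    eq = refl
exponent-cong (suc N) eq = cong₂ _+_ (cong (suc N *_) (eq z<s ≤-refl)) (exponent-cong N λ 0<i i≤N → eq 0<i (m≤n⇒m≤1+n i≤N))

exponent-extend : ∀ {M N μ} → M ≤ N → (∀ {i} → M < i → μ i ≡ 0) → exponent N μ ≡ exponent M μ
exponent-extend {M} {zero}  z≤n eq = refl
exponent-extend {M} {suc N} {μ} M≤N eq with m≤n⇒m<n∨m≡n M≤N
... | inj₂ refl       = refl
... | inj₁ (s≤s M≤N′) = trans
  (cong (_+ exponent N μ) (trans (cong (suc N *_) (eq (s≤s M≤N′))) (*-zeroʳ (suc N))))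
  (exponent-extend M≤N′ eq)

exponent-+ : ∀ N μ ν → exponent N (λ i → μ i + ν i) ≡ exponent N μ + exponent N ν
exponent-+ zero    μ ν = refl
exponent-+ (suc N) μ ν = trans
  (cong₂ _+_ (*-distribˡ-+ (suc N) (μ (suc N)) (ν (suc N))) (exponent-+ N μ ν))
  (interchange (suc N * μ (suc N)) (suc N * ν (suc N)) _ _)
  where
  interchange : ∀ a b c d → (a + b) + (c + d) ≡ (a + c) + (b + d)
  interchange = ℕ-Ring.solve-∀

exponent-indicator : ∀ {M N} → M ≤ N → exponent N (λ i → indicator (i ≤? M)) ≡ exponent M (λ _ → 1)
exponent-indicator {M} M≤N = trans
  (exponent-extend {μ = λ i → indicator (i ≤? M)} M≤N λ M<i → indicator-no (_ ≤? M) (<⇒≱ M<i))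
  (exponent-cong M λ _ i≤M → indicator-yes (_ ≤? M) i≤M)

-- Passing from m to m+1 adds the parts 2m+1 and 2m+2, of sum 4m+3, the exponent in `diagonal-step`.
dom-exponent : ∀ {m N} → 2 * m ≤ N → exponent N (dom-delay m) ≡ Σ< m (λ i → 3 + 4 * i)
dom-exponent {m} le = trans (exponent-indicator le) (go m)
  where
  arith : ∀ m x → (2 + 2 * m) * 1 + ((1 + 2 * m) * 1 + x) ≡ x + (3 + 4 * m)
  arith = ℕ-Ring.solve-∀
  go : ∀ m → exponent (2 * m) (λ _ → 1) ≡ Σ< m (λ i → 3 + 4 * i)
  go zero    = refl
  go (suc m) = begin
    exponent (2 * suc m) (λ _ → 1) ≡⟨ cong (λ N → exponent N (λ _ → 1)) (*-suc 2 m) ⟩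
    exponent (2 + 2 * m) (λ _ → 1) ≡⟨ arith m _ ⟩
    exponent (2 * m) (λ _ → 1) + (3 + 4 * m) ≡⟨ cong (_+ (3 + 4 * m)) (go m) ⟩
    Σ< m (λ i → 3 + 4 * i) + (3 + 4 * m) ≡⟨ Σ<-last m (λ i → 3 + 4 * i) ⟨
    Σ< (suc m) (λ i → 3 + 4 * i) ∎
    where open ≡-Reasoning

-- Passing from j to j+1 adds one copy of j+1 and one of 2j+1, of sum 3j+2, the exponent in
-- `opH-step`.
ic-exponent : ∀ {j N} → 2 * j ≤ N → exponent N (ic-delay j) ≡ Σ< j (λ i → 2 + 3 * i)
ic-exponent {j} {N} le = begin
  exponent N (ic-delay j)
    ≡⟨ exponent-+ N (λ i → indicator (i ≤? j)) (λ i → indicator (odd? i ×-dec (i ≤? 2 * j))) ⟩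
  exponent N (λ i → indicator (i ≤? j)) + exponent N (λ i → indicator (odd? i ×-dec (i ≤? 2 * j)))
    ≡⟨ cong₂ _+_ (exponent-indicator (≤-trans (m≤m+n j _) le)) (trans
         (exponent-extend {μ = λ i → indicator (odd? i ×-dec (i ≤? 2 * j))} le λ j<i →
           indicator-no (odd? _ ×-dec (_ ≤? 2 * j)) λ (_ , i≤) → <⇒≱ j<i i≤)
         (exponent-cong (2 * j) λ {i} _ i≤ →
           indicator-cong (odd? i ×-dec (i ≤? 2 * j)) (odd? i) proj₁ (_, i≤))) ⟩
  exponent j (λ _ → 1) + exponent (2 * j) (λ i → indicator (odd? i))
    ≡⟨ go j ⟩
  Σ< j (λ i → 2 + 3 * i) ∎
  where
  open ≡-Reasoning
  arith : ∀ j x y → (suc j * 1 + x) + ((2 + 2 * j) * 0 + ((1 + 2 * j) * 1 + y)) ≡ (x + y) + (2 + 3 * j)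
  arith = ℕ-Ring.solve-∀
  o : ℕ → ℕ
  o i = indicator (odd? i)
  go : ∀ j → exponent j (λ _ → 1) + exponent (2 * j) o ≡ Σ< j (λ i → 2 + 3 * i)
  go zero    = refl
  go (suc j) = begin
    exponent (suc j) (λ _ → 1) + exponent (2 * suc j) o
      ≡⟨ cong (λ N → exponent (suc j) (λ _ → 1) + exponent N o) (*-suc 2 j) ⟩
    exponent (suc j) (λ _ → 1) + ((2 + 2 * j) * o (2 + 2 * j) + ((1 + 2 * j) * o (1 + 2 * j) + exponent (2 * j) o))
      ≡⟨ cong₂ (λ s t → exponent (suc j) (λ _ → 1) + ((2 + 2 * j) * s + ((1 + 2 * j) * t + exponent (2 * j) o)))
           (indicator-no (odd? (2 + 2 * j)) (λ odd → odd (subst Even (*-suc 2 j) (m∣m*n (suc j)))))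
           (indicator-yes (odd? (1 + 2 * j)) (2∤1+2*m j)) ⟩
    exponent (suc j) (λ _ → 1) + ((2 + 2 * j) * 0 + ((1 + 2 * j) * 1 + exponent (2 * j) o))
      ≡⟨ arith j (exponent j (λ _ → 1)) (exponent (2 * j) o) ⟩
    (exponent j (λ _ → 1) + exponent (2 * j) o) + (2 + 3 * j)
      ≡⟨ cong (_+ (2 + 3 * j)) (go j) ⟩
    Σ< j (λ i → 2 + 3 * i) + (2 + 3 * j)
      ≡⟨ Σ<-last j (λ i → 2 + 3 * i) ⟨
    Σ< (suc j) (λ i → 2 + 3 * i) ∎

Z-delay∞ : ∀ {N n} μ c → Normalised c → n ≤ N →
           Z N (λ i → shift (μ i) (c i)) n ≡ shift (exponent N μ) (Z∞ c) n
Z-delay∞ {N} {n} μ c c₀ n≤N = trans (Z-delay N μ c n)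
  (shift-cong≤ (exponent N μ) λ {k} le → Z≡Z∞ c c₀ (≤-trans (m+n≤o⇒m≤o k le) n≤N))

theorem5p2 : generatingSeries P-dom? (λ π → 2 ^ τ π) ≗ generatingSeries U-ic? (λ _ → 1)
theorem5p2 n = begin
  generatingSeries P-dom? (λ π → 2 ^ τ π) n
    ≡⟨ generatingSeries≡ΣZ P-dom? (λ π → 2 ^ τ π) dom n≤N (dom-only {n}) (dom-τ {n}) ⟩
  Σ< (suc n) (λ m → Z N (dom m) n)
    ≡⟨ Σ<-cong (suc n) (λ {m} m<1+n → trans
         (Z-delay∞ (dom-delay m) (ε (2 * suc m)) (ε-normalised (2 * suc m)) n≤N)
         (cong (λ a → shift a (E (2 * suc m)) n) (dom-exponent {m} (2*≤N m<1+n)))) ⟩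
  Σ< (suc n) (λ m → shift (Σ< m (λ i → 3 + 4 * i)) (E (2 * suc m)) n)
    ≡⟨ rogers (n<1+n n) ⟩
  Σ< (suc n) (λ j → shift (Σ< j (λ i → 2 + 3 * i)) (Z∞ (all-one [ suc (2 * j) ≔ nil ])) n)
    ≡⟨ Σ<-cong (suc n) (λ {j} j<1+n → trans
         (Z-delay∞ (ic-delay j) (all-one [ suc (2 * j) ≔ nil ])
           (≔-normalised all-one (suc (2 * j)) nil (λ _ → refl) refl) n≤N)
         (cong (λ a → shift a (Z∞ (all-one [ suc (2 * j) ≔ nil ])) n) (ic-exponent {j} (2*≤N j<1+n)))) ⟨
  Σ< (suc n) (λ j → Z N (ic j) n)
    ≡⟨ generatingSeries≡ΣZ U-ic? (λ _ → 1) ic n≤N (ic-only {n}) (ic-one {n}) ⟨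
  generatingSeries U-ic? (λ _ → 1) n ∎
  where
  open ≡-Reasoning
  N = suc (2 * n)
  n≤N : n ≤ N
  n≤N = ≤-trans (m≤m+n n _) (n≤1+n _)
  2*≤N : ∀ {m} → m < suc n → 2 * m ≤ N
  2*≤N (s≤s m≤n) = ≤-trans (*-monoʳ-≤ 2 m≤n) (n≤1+n _)
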